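{- For every $\varepsilon>0$ there exists a real number $\kappa=\kappa(\varepsilon)\geq 3$ such that if $\Gamma$ is a distance-regular graph with diameter $D\geq 3$, valency $k\geq \kappa(\varepsilon)$ and $k_2\leq (2-\varepsilon)k$, then $D=3$ and $\Gamma$ is either bipartite or a Taylor graph.
   Context: A connected graph $\Gamma$ of diameter $D$ is distance-regular if there are integers $b_i,c_i$ ($0\le i\le D$) such that for any vertices $x,y$ at distance $i$, exactly $c_i$ neighbours of $y$ lie at distance $i-1$ from $x$ and exactly $b_i$ at distance $i+1$ from $x$; $k=b_0$ is the valency. $k_2$ denotes the number of vertices at distance exactly $2$ from a fixed vertex (independent of the vertex). A Taylor graph is a distance-regular graph with intersection array $\{k,\mu,1;1,\mu,k\}$, i.e. $D=3$, $b_0=k,b_1=\mu,b_2=1$, $c_1=1,c_2=\mu,c_3=k$. -}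

module Defs where

open import Data.Nat using (ℕ; zero; suc; _∸_; _≤_; _<_)
open import Data.Fin using (Fin)
open import Data.Bool using (Bool)
open import Data.List using (List; length)
open import Data.List.Membership.Propositional using (_∈_)
open import Data.List.Relation.Unary.Unique.Propositional using (Unique)
open import Data.Product using (Σ; ∃; ∃-syntax; _×_; _,_)
open import Relation.Nullary using (¬_)
open import Relation.Binary.PropositionalEquality using (_≡_; _≢_)
open import Function.Bundles using (_⇔_)
open import Data.Rational using (ℚ; _/_)
open import Data.Integer using (+_)

record Graph : Set₁ where
  field
    n      : ℕ
    Adj    : Fin n → Fin n → Set
    sym    : ∀ {x y} → Adj x y → Adj y x
    irrefl : ∀ {x} → ¬ Adj x x

HasSize : {A : Set} → (A → Set) → ℕ → Set
HasSize {A} P m = Σ (List A) λ l → Unique l × (∀ z → (z ∈ l) ⇔ P z) × length l ≡ m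

module _ (G : Graph) where
  open Graph G

  data Walk : Fin n → Fin n → ℕ → Set where
    nil  : ∀ {x} → Walk x x 0
    cons : ∀ {x y z m} → Adj x y → Walk y z m → Walk x z (suc m)

  Dist : Fin n → Fin n → ℕ → Set
  Dist x y i = Walk x y i × (∀ j → j Data.Nat.< i → ¬ Walk x y j)

  Connected : Set
  Connected = ∀ x y → ∃[ i ] Dist x y i

  HasDiameter : ℕ → Set
  HasDiameter D = Connected × (∀ x y i → Dist x y i → i Data.Nat.≤ D)
                            × (∃[ x ] ∃[ y ] Dist x y D)

  IsDistanceRegular : ℕ → (ℕ → ℕ) → (ℕ → ℕ) → Set
  IsDistanceRegular D b c =
    HasDiameter D ×
    (∀ x y i → Dist x y i →
        HasSize (λ z → Adj y z × Dist x z (i ∸ 1)) (c i) ×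
        HasSize (λ z → Adj y z × Dist x z (suc i)) (b i))

  HasK2 : ℕ → Set
  HasK2 k₂ = ∀ x → HasSize (λ z → Dist x z 2) k₂

  Bipartite : Set
  Bipartite = Σ (Fin n → Bool) λ f → ∀ x y → Adj x y → f x ≢ f y

-- Taylor graph: intersection array {k, μ, 1; 1, μ, k} (with D = 3)
IsTaylorArray : ℕ → (ℕ → ℕ) → (ℕ → ℕ) → Set
IsTaylorArray D b c = D ≡ 3 × ∃[ μ ] (b 1 ≡ μ × b 2 ≡ 1 × c 1 ≡ 1 × c 2 ≡ μ × c 3 ≡ b 0)

ℕ→ℚ : ℕ → ℚ
ℕ→ℚ m = (+ m) / 1

{-# OPTIONS --safe #-}

-- Write a for the number of common neighbours of adjacent vertices. If a = o(k), then k₂ ≤ (2 - ε)k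
-- gives 2c₂ > k, which rules out edges inside every sphere around a vertex, so the graph is bipartite.
-- Otherwise a is linear in k. Ramsey's theorem gives a large family X of neighbours of a vertex that
-- are pairwise at the same distance. Their neighbourhoods have constant pairwise intersection, so by
-- Cauchy–Schwarz every vertex w has, up to o(|X|²) pairs, the same number of common neighbours with
-- the members of X. Counting the exceptional pairs forces a = c₂ + o(k), and then a second application
-- of the same inequality bounds b₂, so D = 3 and c₃ = k - O(1). Finally, for d(x, z) = 3, counting the
-- paths of length two from z through Γ₂(x) to Γ₃(x) gives b₂ ≤ k₂ / k + o(1) < 2, so b₂ = 1, k₃ = 1 and
-- Γ is a Taylor graph.
module Submission where

open import Defs
open import Data.Bool.Base using (Bool; true; false; if_then_else_; not)
open import Data.Bool.Properties using (not-¬)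
open import Data.Empty using (⊥; ⊥-elim)
open import Data.Fin.Base using (Fin; zero; suc; toℕ)
open import Data.Fin.Properties using (toℕ-injective)
import Data.Integer.Base as ℤ
import Data.Integer.Properties as ℤₚ
open import Data.Integer.Tactic.RingSolver using (solve; solve-∀)
open import Data.List.Base using (List; []; _∷_; length; lookup)
open import Data.List.Membership.Propositional using (_∈_; _∉_)
open import Data.List.Membership.Propositional.Properties using (∈-lookup)
open import Data.List.Relation.Binary.Sublist.Propositional.Properties using (All-resp-⊆)
open import Data.List.Relation.Unary.Any using (here; there)
open import Data.List.Relation.Unary.Unique.Propositional using (Unique)
open import Data.Nat using (ℕ; _≥_)
open import Data.Nat.Base as ℕ using (zero; suc; z≤n; s≤s)
import Data.Nat.Properties as ℕₚ
open import Data.Product using (Σ; _×_)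
open import Data.Product.Base using (∃-syntax; _,_; proj₁; proj₂)
import Data.Rational.Base as ℚ
import Data.Rational.Properties as ℚₚ
import Data.Rational.Unnormalised.Base as ℚᵘ
import Data.Rational.Unnormalised.Properties as ℚᵘₚ
open import Data.Sum using (_⊎_)
open import Data.Sum.Base using (inj₁; inj₂; [_,_]′)
open import Function.Base using (_∘_; case_of_; _⟨_⟩_)
open import Function.Bundles using (Equivalence)
open import Relation.Binary.PropositionalEquality using (_≡_)
open import Relation.Binary.PropositionalEquality
  using (_≢_; refl; sym; trans; cong; cong₂; subst; subst₂; module ≡-Reasoning)
open import Relation.Nullary using (¬_; yes; no)

-- The two-block inequality carries a loss `2pq(M - N)`, where `M` bounds common neighbours from
-- above and `N` bounds them from below across the blocks. With `a₁` and `c₂` far apart this loss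
-- can swallow the gain, so `b₂` cannot be bounded directly. In a family at constant distance
-- `M = N` and the loss vanishes; that is why Ramsey's theorem comes first. It yields |`a₁` - `c₂`|
-- ≤ `e` with `e` a small fraction of `k`, and then `M = c₂ + e`, `N = c₂` give a bound on `b₂`
-- independent of `k`. The gain is weighted by the number of vertices adjacent to one member of a
-- pair and at distance 2 from the other: `b₁` for a clique, `a₂` for a coclique. That `a₂` is
-- linear in `k` is not clear beforehand, so a coclique is first tested against distance 3, where
-- the comparison value is 0; this makes `b₂` a small fraction of `k`. All estimates are over the
-- integers. The denominator `ν` of `ε` replaces `ε` by `1/ν`, and "o(k)" becomes `T * e ≤ k` for a
-- constant `T` fixed in advance.

module Combinatorics where

  open import Algebra.Properties.Semiring.Sum ℤₚ.+-*-semiring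
    using (sum; ∑-distrib-+; ∑-comm; *-distribˡ-sum; sum-cong-≗; sum-replicate-zero)
  open import Data.Integer.Base
    using (ℤ; +_; 0ℤ; 1ℤ; _+_; _-_; _*_; -_; _≤_; _<_; ∣_∣; +≤+; nonNegative)

  -- Sums are opaque so that unification compares summands instead of unfolding.
  opaque
    ∑ : ∀ {n} → (Fin n → ℤ) → ℤ
    ∑ = sum

  -- Inequalities over ℤ are certified by writing the difference of the two sides as a
  -- combination of nonnegative terms, an identity left to the ring solver.

  by-difference : ∀ {x y e} → 0ℤ ≤ e → y - x ≡ e → x ≤ y
  by-difference 0≤e eq = ℤₚ.0≤i-j⇒j≤i (subst (0ℤ ≤_) (sym eq) 0≤e)

  ≤-+ʳ : ∀ {x y} → 0ℤ ≤ y → x ≤ x + y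
  ≤-+ʳ {x} {y} h = by-difference h (cancel x y)
    where
    cancel : ∀ x y → x + y - x ≡ y
    cancel = solve-∀

  ≤-+ˡ : ∀ {x y} → 0ℤ ≤ x → y ≤ x + y
  ≤-+ˡ {x} {y} h = by-difference h (cancel x y)
    where
    cancel : ∀ x y → x + y - y ≡ x
    cancel = solve-∀

  gap : ∀ {x y} → x ≤ y → 0ℤ ≤ y - x
  gap = ℤₚ.i≤j⇒0≤j-i

  infixl 6 _⊕_
  infixl 7 _⊗_

  _⊕_ : ∀ {x y} → 0ℤ ≤ x → 0ℤ ≤ y → 0ℤ ≤ x + y
  p ⊕ q = ℤₚ.+-mono-≤ p q

  _⊗_ : ∀ {x y} → 0ℤ ≤ x → 0ℤ ≤ y → 0ℤ ≤ x * y
  _⊗_ {+ m} {+ n} _ _ = subst (0ℤ ≤_) (ℤₚ.pos-* m n) (+≤+ z≤n)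

  square-nonneg : ∀ x → 0ℤ ≤ x * x
  square-nonneg (+ n)         = +≤+ {n = n} z≤n ⊗ +≤+ {n = n} z≤n
  square-nonneg (ℤ.negsuc n) = +≤+ z≤n

  +-nonneg : ∀ {n} → 0ℤ ≤ + n
  +-nonneg = +≤+ z≤n

  <⇒1+≤ : ∀ {x y} → x < y → x + 1ℤ ≤ y
  <⇒1+≤ {x} {y} x<y = subst (_≤ y) (ℤₚ.+-comm 1ℤ x) (ℤₚ.i<j⇒suc[i]≤j x<y)

  1+≤⇒≰ : ∀ {x y} → x + 1ℤ ≤ y → ¬ y ≤ x
  1+≤⇒≰ {x} {y} p q = ℤₚ.<⇒≱ (ℤₚ.suc[i]≤j⇒i<j (subst (_≤ y) (ℤₚ.+-comm x 1ℤ) p)) q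

  -- Closes refutations: a combination of nonnegative terms that the ring solver evaluates to the
  -- constant `-(m + 1)`.
  impossible : ∀ {e} → 0ℤ ≤ e → ∀ m → e ≡ - + suc m → ⊥
  impossible () m refl

  ≤-or-> : ∀ x y → x ≤ y ⊎ y + 1ℤ ≤ x
  ≤-or-> x y with x ℤₚ.≤? y
  ... | yes p = inj₁ p
  ... | no  p = inj₂ (<⇒1+≤ (ℤₚ.≰⇒> p))

  cancel-positive : ∀ {z x y} → 1ℤ ≤ z → z * x ≤ z * y → x ≤ y
  cancel-positive {+ suc m} _ p = ℤₚ.*-cancelˡ-≤-pos _ _ (+ suc m) p
  cancel-positive {+ zero} (+≤+ ()) p

  -- Finite sums and indicator functions

  opaque
    unfolding ∑

    ∑-mono : ∀ {n} {f g : Fin n → ℤ} → (∀ i → f i ≤ g i) → ∑ f ≤ ∑ g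
    ∑-mono {zero}  h = ℤₚ.≤-refl
    ∑-mono {suc n} h = ℤₚ.+-mono-≤ (h zero) (∑-mono (h ∘ suc))

    ∑-cong : ∀ {n} {f g : Fin n → ℤ} → (∀ i → f i ≡ g i) → ∑ f ≡ ∑ g
    ∑-cong = sum-cong-≗

    ∑-nonneg : ∀ {n} {f : Fin n → ℤ} → (∀ i → 0ℤ ≤ f i) → 0ℤ ≤ ∑ f
    ∑-nonneg {n} {f} h = subst (_≤ ∑ f) (sum-replicate-zero n) (∑-mono h)

    ∑-positive : ∀ {n} (f : Fin n → ℤ) → 1ℤ ≤ ∑ f → ∃[ i ] 1ℤ ≤ f i
    ∑-positive {zero}  f (+≤+ ())
    ∑-positive {suc n} f h with ≤-or-> (f zero) 0ℤ
    ... | inj₂ p = zero , p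
    ... | inj₁ p with ∑-positive (f ∘ suc) (ℤₚ.≤-trans h
                        (subst (f zero + ∑ (f ∘ suc) ≤_) (ℤₚ.+-identityˡ _)
                          (ℤₚ.+-monoˡ-≤ (∑ (f ∘ suc)) p)))
    ...   | i , q = suc i , q

    ∑-* : ∀ {n} x (f : Fin n → ℤ) → ∑ (λ i → x * f i) ≡ x * ∑ f
    ∑-* x f = sym (*-distribˡ-sum x f)

    ∑-+ : ∀ {n} (f g : Fin n → ℤ) → ∑ (λ i → f i + g i) ≡ ∑ f + ∑ g
    ∑-+ = ∑-distrib-+

    ∑-swap : ∀ {m n} (f : Fin m → Fin n → ℤ) → ∑ (λ i → ∑ (f i)) ≡ ∑ (λ j → ∑ (λ i → f i j))
    ∑-swap = ∑-comm

    ∑-zero : ∀ n → ∑ {n} (λ _ → 0ℤ) ≡ 0ℤ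
    ∑-zero = sum-replicate-zero

    ∑-suc : ∀ {n} (f : Fin (suc n) → ℤ) → ∑ f ≡ f zero + ∑ (f ∘ suc)
    ∑-suc f = refl

  -- A summand brought to this shape is summed by linearity in one step. The shape ends in `0ℤ`,
  -- hence the trailing `+ 0ℤ` in the ring identities below.
  combination : ∀ {n} → List (ℤ × (Fin n → ℤ)) → Fin n → ℤ
  combination []             i = 0ℤ
  combination ((c , f) ∷ cs) i = c * f i + combination cs i

  combination-∑ : ∀ {n} → List (ℤ × (Fin n → ℤ)) → ℤ
  combination-∑ []             = 0ℤ
  combination-∑ ((c , f) ∷ cs) = c * ∑ f + combination-∑ cs

  ∑-combination : ∀ {n} (cs : List (ℤ × (Fin n → ℤ))) → ∑ (combination cs) ≡ combination-∑ cs
  ∑-combination {n} []       = ∑-zero n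
  ∑-combination ((c , f) ∷ cs) =
    trans (∑-+ (λ i → c * f i) (combination cs)) (cong₂ _+_ (∑-* c f) (∑-combination cs))

  ∑-product : ∀ {m n} (f : Fin m → ℤ) (g : Fin n → ℤ) → ∑ (λ i → ∑ (λ j → f i * g j)) ≡ ∑ f * ∑ g
  ∑-product f g = begin
    ∑ (λ i → ∑ (λ j → f i * g j))  ≡⟨ ∑-cong (λ i → trans (∑-* (f i) g) (ℤₚ.*-comm (f i) (∑ g))) ⟩
    ∑ (λ i → ∑ g * f i)            ≡⟨ ∑-* (∑ g) f ⟩
    ∑ g * ∑ f                      ≡⟨ ℤₚ.*-comm (∑ g) (∑ f) ⟩
    ∑ f * ∑ g                      ∎
    where open ≡-Reasoning

  δ : ℕ → ℕ → ℤ
  δ i j = if i ℕ.≡ᵇ j then 1ℤ else 0ℤ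

  δ-cases : ∀ i j → (i ≡ j × δ i j ≡ 1ℤ) ⊎ (i ≢ j × δ i j ≡ 0ℤ)
  δ-cases zero    zero    = inj₁ (refl , refl)
  δ-cases zero    (suc j) = inj₂ ((λ ()) , refl)
  δ-cases (suc i) zero    = inj₂ ((λ ()) , refl)
  δ-cases (suc i) (suc j) with δ-cases i j
  ... | inj₁ (p , q) = inj₁ (cong suc p , q)
  ... | inj₂ (p , q) = inj₂ (p ∘ ℕₚ.suc-injective , q)

  δ-1 : ∀ {i j} → i ≡ j → δ i j ≡ 1ℤ
  δ-1 {i} {j} p with δ-cases i j
  ... | inj₁ (_ , q) = q
  ... | inj₂ (¬p , _) = ⊥-elim (¬p p)

  δ-0 : ∀ {i j} → i ≢ j → δ i j ≡ 0ℤ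
  δ-0 {i} {j} ¬p with δ-cases i j
  ... | inj₁ (p , _) = ⊥-elim (¬p p)
  ... | inj₂ (_ , q) = q

  δ-nonneg : ∀ i j → 0ℤ ≤ δ i j
  δ-nonneg i j with i ℕ.≡ᵇ j
  ... | true  = +-nonneg
  ... | false = +-nonneg

  δ-≤1 : ∀ i j → δ i j ≤ 1ℤ
  δ-≤1 i j with i ℕ.≡ᵇ j
  ... | true  = ℤₚ.≤-refl
  ... | false = +-nonneg

  δ-idem : ∀ i j → δ i j * δ i j ≡ δ i j
  δ-idem i j with i ℕ.≡ᵇ j
  ... | true  = refl
  ... | false = refl

  -- Lets a summand be rewritten under the condition that its indicator expresses; elsewhere both
  -- sides vanish.
  under-δ-≡ : ∀ i j {f g} → (i ≡ j → f ≡ g) → δ i j * f ≡ δ i j * g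
  under-δ-≡ i j {f} {g} h with δ-cases i j
  ... | inj₁ (p , _) = cong (δ i j *_) (h p)
  ... | inj₂ (_ , q) = trans (cong (_* f) q) (sym (cong (_* g) q))

  under-δ-≤ : ∀ i j {f g} → (i ≡ j → f ≤ g) → δ i j * f ≤ δ i j * g
  under-δ-≤ i j {f} {g} h with δ-cases i j
  ... | inj₁ (p , _) = ℤₚ.*-monoˡ-≤-nonNeg (δ i j) {{nonNegative (δ-nonneg i j)}} (h p)
  ... | inj₂ (_ , q) = ℤₚ.≤-reflexive (trans (cong (_* f) q) (sym (cong (_* g) q)))

  ∑-δ : ∀ {n} (i : Fin n) (f : Fin n → ℤ) → ∑ (λ j → δ (toℕ i) (toℕ j) * f j) ≡ f i
  ∑-δ {suc n} zero    f = begin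
    ∑ (λ j → δ 0 (toℕ j) * f j)             ≡⟨ ∑-suc {n} (λ j → δ 0 (toℕ j) * f j) ⟩
    1ℤ * f zero + ∑ (λ j → 0ℤ * f (suc j))  ≡⟨ cong₂ _+_ (ℤₚ.*-identityˡ (f zero)) (∑-* 0ℤ (f ∘ suc)) ⟩
    f zero + 0ℤ * ∑ (f ∘ suc)               ≡⟨ ℤₚ.+-identityʳ (f zero) ⟩
    f zero                                  ∎
    where open ≡-Reasoning
  ∑-δ {suc n} (suc i) f = begin
    ∑ (λ j → δ (suc (toℕ i)) (toℕ j) * f j)              ≡⟨ ∑-suc {n} (λ j → δ (suc (toℕ i)) (toℕ j) * f j) ⟩
    0ℤ * f zero + ∑ (λ j → δ (toℕ i) (toℕ j) * f (suc j))  ≡⟨ ℤₚ.+-identityˡ _ ⟩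
    ∑ (λ j → δ (toℕ i) (toℕ j) * f (suc j))              ≡⟨ ∑-δ i (f ∘ suc) ⟩
    f (suc i)                                            ∎
    where open ≡-Reasoning

  -- Inner products and the two-block inequality

  infix 8 _∙_

  _∙_ : ∀ {n} → (Fin n → ℤ) → (Fin n → ℤ) → ℤ
  f ∙ g = ∑ (λ s → f s * g s)

  weighted : ∀ {m l} → (Fin l → ℤ) → (Fin l → Fin m → ℤ) → Fin m → ℤ
  weighted e X s = ∑ (λ i → e i * X i s)

  ∙-weighted : ∀ {m l} (w : Fin m → ℤ) (e : Fin l → ℤ) (X : Fin l → Fin m → ℤ) →
               w ∙ weighted e X ≡ ∑ (λ i → e i * (w ∙ X i))
  ∙-weighted w e X = begin
    ∑ (λ s → w s * ∑ (λ i → e i * X i s))    ≡⟨ ∑-cong (λ s → sym (∑-* (w s) _)) ⟩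
    ∑ (λ s → ∑ (λ i → w s * (e i * X i s)))  ≡⟨ ∑-swap _ ⟩
    ∑ (λ i → ∑ (λ s → w s * (e i * X i s)))  ≡⟨ ∑-cong (λ i → ∑-cong (λ s → swap (w s) (e i) (X i s))) ⟩
    ∑ (λ i → ∑ (λ s → e i * (w s * X i s)))  ≡⟨ ∑-cong (λ i → ∑-* (e i) _) ⟩
    ∑ (λ i → e i * (w ∙ X i))                ∎
    where
    open ≡-Reasoning
    swap : ∀ x y z → x * (y * z) ≡ y * (x * z)
    swap = solve-∀

  weighted-∙-weighted : ∀ {m l} (e f : Fin l → ℤ) (X : Fin l → Fin m → ℤ) →
    weighted e X ∙ weighted f X ≡ ∑ (λ j → ∑ (λ i → e i * f j * (X i ∙ X j)))
  weighted-∙-weighted e f X = trans (∙-weighted (weighted e X) f X) (∑-cong λ j → begin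
    f j * (weighted e X ∙ X j)                ≡⟨ cong (f j *_) (trans (∑-cong (λ s → ℤₚ.*-comm _ (X j s))) (∙-weighted (X j) e X)) ⟩
    f j * ∑ (λ i → e i * (X j ∙ X i))         ≡⟨ ∑-* (f j) _ ⟨
    ∑ (λ i → f j * (e i * (X j ∙ X i)))       ≡⟨ ∑-cong (λ i → trans (swap (f j) (e i) _)
                                                   (cong (e i * f j *_) (∑-cong (λ s → ℤₚ.*-comm (X j s) (X i s))))) ⟩
    ∑ (λ i → e i * f j * (X i ∙ X j))         ∎)
    where
    open ≡-Reasoning
    swap : ∀ x y z → x * (y * z) ≡ y * x * z
    swap = solve-∀

  -- The off-diagonal bound `M` contributes `M` times the square of `∑ I`; the extra `k` on the
  -- diagonal contributes `k * ∑ I`, because the weights are idempotent.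
  self-weighted-bound : ∀ {m l} (k M : ℤ) (X : Fin l → Fin m → ℤ) (I : Fin l → ℤ) →
    (∀ i → 0ℤ ≤ I i) → (∀ i → I i * I i ≡ I i) →
    (∀ i j → X i ∙ X j ≤ M + k * δ (toℕ j) (toℕ i)) →
    weighted I X ∙ weighted I X ≤ ∑ I * (∑ I * M + k)
  self-weighted-bound k M X I 0≤I idem gram = begin
    weighted I X ∙ weighted I X                                            ≡⟨ weighted-∙-weighted I I X ⟩
    ∑ (λ j → ∑ (λ i → I i * I j * (X i ∙ X j)))                            ≤⟨ ∑-mono (λ j → ∑-mono (λ i → bound i j)) ⟩
    ∑ (λ j → ∑ (λ i → I i * I j * (M + k * δ (toℕ j) (toℕ i))))            ≡⟨ ∑-cong inner ⟩
    ∑ (λ j → (∑ I * M + k) * I j)                                          ≡⟨ ∑-* (∑ I * M + k) I ⟩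
    (∑ I * M + k) * ∑ I                                                    ≡⟨ ℤₚ.*-comm _ (∑ I) ⟩
    ∑ I * (∑ I * M + k)                                                    ∎
    where
    open ℤₚ.≤-Reasoning
    bound : ∀ i j → I i * I j * (X i ∙ X j) ≤ I i * I j * (M + k * δ (toℕ j) (toℕ i))
    bound i j = ℤₚ.*-monoˡ-≤-nonNeg (I i * I j) {{nonNegative (0≤I i ⊗ 0≤I j)}} (gram i j)
    expand : ∀ x y M k d → x * y * (M + k * d) ≡ y * M * x + (k * y * (d * x) + 0ℤ)
    expand = solve-∀
    collect : ∀ y M p k → y * M * p + (k * y * y + 0ℤ) ≡ p * M * y + k * (y * y)
    collect = solve-∀
    collect′ : ∀ y M p k → p * M * y + k * y ≡ (p * M + k) * y
    collect′ = solve-∀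
    inner : ∀ j → ∑ (λ i → I i * I j * (M + k * δ (toℕ j) (toℕ i))) ≡ (∑ I * M + k) * I j
    inner j = trans (∑-cong (λ i → expand (I i) (I j) M k (δ (toℕ j) (toℕ i))))
      (trans (∑-combination ((I j * M , I) ∷ (k * I j , λ i → δ (toℕ j) (toℕ i) * I i) ∷ []))
      (trans (cong (λ z → I j * M * ∑ I + (k * I j * z + 0ℤ)) (∑-δ j I))
      (trans (collect (I j) M (∑ I) k)
      (trans (cong (λ z → ∑ I * M * I j + k * z) (idem j)) (collect′ (I j) M (∑ I) k)))))

  -- Cauchy–Schwarz for w against the combination of the X i with weight ∑ J on the block I
  -- and weight - ∑ I on the block J, in which the mean of the X i cancels.
  two-block-inequality : ∀ {m l} (k M N h h′ : ℤ) (w : Fin m → ℤ) (X : Fin l → Fin m → ℤ) (I J : Fin l → ℤ) →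
    1ℤ ≤ k → N ≤ M → w ∙ w ≡ k →
    (∀ i → 0ℤ ≤ I i) → (∀ i → I i * I i ≡ I i) →
    (∀ j → 0ℤ ≤ J j) → (∀ j → J j * J j ≡ J j) →
    (∀ i j → X i ∙ X j ≤ M + k * δ (toℕ j) (toℕ i)) →
    (∀ i j → I i * J j * N ≤ I i * J j * (X i ∙ X j)) →
    (∀ i → I i * (w ∙ X i) ≡ I i * h) →
    (∀ j → J j * (w ∙ X j) ≡ J j * h′) →
    ∑ I * ∑ J * ((h - h′) * (h - h′)) ≤ k * (k * (∑ I + ∑ J) + + 2 * (∑ I * ∑ J) * (M - N))
  two-block-inequality k M N h h′ w X I J 1≤k N≤M ww 0≤I Iid 0≤J Jid gram cross wI wJ = conclusion
    where
    p = ∑ I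
    q = ∑ J
    g = h - h′
    P = weighted I X
    Q = weighted J X
    T = p * q * g

    0≤p : 0ℤ ≤ p
    0≤p = ∑-nonneg 0≤I
    0≤q : 0ℤ ≤ q
    0≤q = ∑-nonneg 0≤J
    0≤k : 0ℤ ≤ k
    0≤k = ℤₚ.≤-trans +-nonneg 1≤k

    wP : w ∙ P ≡ h * p
    wP = trans (∙-weighted w I X) (trans (∑-cong (λ i → trans (wI i) (ℤₚ.*-comm (I i) h))) (∑-* h I))
    wQ : w ∙ Q ≡ h′ * q
    wQ = trans (∙-weighted w J X) (trans (∑-cong (λ i → trans (wJ i) (ℤₚ.*-comm (J i) h′))) (∑-* h′ J))
    PQ : p * q * N ≤ P ∙ Q
    PQ = begin
      p * q * N                                        ≡⟨ arrange p q N ⟩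
      N * q * p                                        ≡⟨ ∑-* (N * q) I ⟨
      ∑ (λ i → N * q * I i)                            ≡⟨ ∑-cong (λ i → trans (arrange′ N q (I i)) (sym (∑-* (I i * N) J))) ⟩
      ∑ (λ i → ∑ (λ j → I i * N * J j))                ≡⟨ ∑-swap (λ i j → I i * N * J j) ⟩
      ∑ (λ j → ∑ (λ i → I i * N * J j))                ≤⟨ ∑-mono (λ j → ∑-mono (λ i → ℤₚ.≤-trans (ℤₚ.≤-reflexive (arrange″ (I i) N (J j))) (cross i j))) ⟩
      ∑ (λ j → ∑ (λ i → I i * J j * (X i ∙ X j)))      ≡⟨ weighted-∙-weighted I J X ⟨
      P ∙ Q                                            ∎
      where
      open ℤₚ.≤-Reasoning
      arrange : ∀ p q N → p * q * N ≡ N * q * p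
      arrange = solve-∀
      arrange′ : ∀ N q x → N * q * x ≡ x * N * q
      arrange′ = solve-∀
      arrange″ : ∀ x N y → x * N * y ≡ x * y * N
      arrange″ = solve-∀

    -- The expansion of the squared norm of `T w - k v` with `v = q P - p Q`. Since `w ∙ w = k` and
    -- `w ∙ v = T`, it equals `k * (k * (v ∙ v) - T * T)`, so its nonnegativity is Cauchy-Schwarz
    -- without a division.
    terms : List (ℤ × (Fin _ → ℤ))
    terms = (T * T , λ s → w s * w s) ∷ (- + 2 * T * k * q , λ s → w s * P s) ∷ (+ 2 * T * k * p , λ s → w s * Q s)
          ∷ (k * k * q * q , λ s → P s * P s) ∷ (k * k * p * p , λ s → Q s * Q s)
          ∷ (- + 2 * k * k * p * q , λ s → P s * Q s) ∷ []

    square-form : ∀ T k p q w P Q → (T * w - k * (q * P - p * Q)) * (T * w - k * (q * P - p * Q)) ≡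
      T * T * (w * w) + (- + 2 * T * k * q * (w * P) + (+ 2 * T * k * p * (w * Q) + (k * k * q * q * (P * P)
      + (k * k * p * p * (Q * Q) + (- + 2 * k * k * p * q * (P * Q) + 0ℤ)))))
    square-form = solve-∀

    0≤terms : 0ℤ ≤ combination-∑ terms
    0≤terms = subst (0ℤ ≤_) (∑-combination terms)
      (∑-nonneg λ s → subst (0ℤ ≤_) (square-form T k p q (w s) (P s) (Q s)) (square-nonneg (T * w s - k * (q * P s - p * Q s))))

    certificate : ∀ k p q h h′ M N PP QQ PQ →
      let T = p * q * (h - h′) in
      k * (p * q) * (k * (k * (p + q) + + 2 * (p * q) * (M - N))) - k * (p * q) * (p * q * ((h - h′) * (h - h′))) ≡
      T * T * k + (- + 2 * T * k * q * (h * p) + (+ 2 * T * k * p * (h′ * q) + (k * k * q * q * PP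
      + (k * k * p * p * QQ + (- + 2 * k * k * p * q * PQ + 0ℤ)))))
      + k * k * (q * q) * (p * (p * M + k) - PP) + k * k * (p * p) * (q * (q * M + k) - QQ)
      + + 2 * (k * k) * (p * q) * (PQ - p * q * N)
    certificate = solve-∀

    scaled : k * (p * q) * (p * q * (g * g)) ≤ k * (p * q) * (k * (k * (p + q) + + 2 * (p * q) * (M - N)))
    scaled = by-difference
      (subst (0ℤ ≤_) (cong₂ _+_ (cong (T * T *_) ww) (cong₂ _+_ (cong (- + 2 * T * k * q *_) wP)
         (cong (_+ (k * k * q * q * (P ∙ P) + (k * k * p * p * (Q ∙ Q) + (- + 2 * k * k * p * q * (P ∙ Q) + 0ℤ))))
               (cong (+ 2 * T * k * p *_) wQ)))) 0≤terms
       ⊕ square-nonneg k ⊗ square-nonneg q ⊗ gap (self-weighted-bound k M X I 0≤I Iid gram)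
       ⊕ square-nonneg k ⊗ square-nonneg p ⊗ gap (self-weighted-bound k M X J 0≤J Jid gram)
       ⊕ (+-nonneg {2} ⊗ square-nonneg k) ⊗ (0≤p ⊗ 0≤q) ⊗ gap PQ)
      (certificate k p q h h′ M N (P ∙ P) (Q ∙ Q) (P ∙ Q))

    conclusion : p * q * (g * g) ≤ k * (k * (p + q) + + 2 * (p * q) * (M - N))
    -- The factor `k * (p * q)` can be cancelled only if both blocks are nonempty; otherwise the
    -- left side is zero.
    conclusion with ≤-or-> (p * q) 0ℤ
    ... | inj₂ 1≤pq = cancel-positive {k * (p * q)} {p * q * (g * g)} {k * (k * (p + q) + + 2 * (p * q) * (M - N))} (ℤₚ.≤-trans 1≤k (by-difference (0≤k ⊗ gap 1≤pq) (factor k (p * q)))) scaled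
      where
      factor : ∀ k x → k * x - k ≡ k * (x - (0ℤ + 1ℤ))
      factor = solve-∀
    ... | inj₁ pq≤0 = by-difference
      (0≤k ⊗ (0≤k ⊗ (0≤p ⊕ 0≤q) ⊕ +-nonneg {2} ⊗ (0≤p ⊗ 0≤q) ⊗ gap N≤M) ⊕ gap pq≤0 ⊗ square-nonneg g)
      (zero-form (k * (k * (p + q) + + 2 * (p * q) * (M - N))) (p * q) (g * g))
      where
      zero-form : ∀ z x y → z - x * y ≡ z + (0ℤ - x) * y
      zero-form = solve-∀

  ≤-by-contradiction : ∀ {x y} → (y + 1ℤ ≤ x → ⊥) → x ≤ y
  ≤-by-contradiction {x} {y} f with ≤-or-> x y
  ... | inj₁ p = p
  ... | inj₂ p = ⊥-elim (f p)

  square-cancel-≤ : ∀ {x y} → 0ℤ ≤ y → x * x ≤ y * y → x ≤ y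
  square-cancel-≤ {x} {y} 0≤y h = ≤-by-contradiction {x} {y} λ p →
    let e = gap h ⊕ gap p ⊗ (gap p ⊕ (0≤y ⊕ 0≤y) ⊕ +-nonneg {1}) ⊕ (gap p ⊕ (0≤y ⊕ 0≤y))
    in impossible e 0 (solve (x ∷ y ∷ []))

  -- Numerical estimates for the intersection numbers

  module Estimates {n k b₁ c₂ k₂ : ℤ}
    (1≤n : 1ℤ ≤ n) (1≤k : 1ℤ ≤ k) (0≤c₂ : 0ℤ ≤ c₂)
    (k₂-small : n * k₂ + k ≤ + 2 * n * k) (k₂c₂ : k₂ * c₂ ≡ k * b₁)
    (c₂≤b₁ : c₂ ≤ b₁) (0≤a : 0ℤ ≤ k - 1ℤ - b₁) (2a≤ : (k - 1ℤ - b₁) + (k - 1ℤ - b₁) ≤ k + c₂)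
    where

    0≤n : 0ℤ ≤ n
    0≤n = ℤₚ.≤-trans +-nonneg 1≤n

    0≤k : 0ℤ ≤ k
    0≤k = ℤₚ.≤-trans +-nonneg 1≤k

    -- The hypothesis on `k₂` times `c₂`, with `k₂ * c₂` replaced by `k * b₁` and `k` cancelled:
    -- `b₁ ≤ (2 - 1/n) c₂`.
    b₁-small : n * b₁ + c₂ ≤ + 2 * n * c₂
    b₁-small =
      let e = 0≤c₂ ⊗ gap k₂-small ⊕ 0≤n ⊗ gap (ℤₚ.≤-reflexive (sym k₂c₂))
      in cancel-positive {k} {n * b₁ + c₂} {+ 2 * n * c₂} 1≤k (by-difference e (solve (n ∷ k ∷ b₁ ∷ c₂ ∷ k₂ ∷ [])))

    module Sparse (a-small : + 3 * n * (k - 1ℤ - b₁ + 1ℤ) + 1ℤ ≤ k) where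

      -- If `2c₂ ≤ k`, then `b₁-small` gives `k ≤ 2n(a + 1)` for `a = k - 1 - b₁`, against
      -- `a-small`.
      k<2c₂ : k + 1ℤ ≤ c₂ + c₂
      k<2c₂ = ≤-by-contradiction {k + 1ℤ} {c₂ + c₂} λ p →
        let e = (gap 1≤n ⊕ 0≤n) ⊗ gap p ⊕ +-nonneg {2} ⊗ gap b₁-small ⊕ gap a-small ⊕ 0≤n ⊗ (0≤a ⊕ +-nonneg {1})
        in impossible e 0 (solve (n ∷ k ∷ b₁ ∷ c₂ ∷ []))

      no-triangles : ¬ k + k ≤ + 2 + + 3 * (k - 1ℤ - b₁) + k₂
      no-triangles p =
        let e = gap a-small ⊕ 0≤n ⊕ 0≤n ⊗ gap p ⊕ gap k₂-small
        in impossible e 0 (solve (n ∷ k ∷ b₁ ∷ k₂ ∷ []))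

    module Dense (a-large : k ≤ + 3 * n * (k - 1ℤ - b₁ + 1ℤ)) (6n≤k : + 6 * n ≤ k) (14≤k : + 14 ≤ k) where

      k≤6na : k ≤ + 6 * n * (k - 1ℤ - b₁)
      k≤6na =
        let e = +-nonneg {2} ⊗ gap a-large ⊕ gap 6n≤k
        in by-difference e (solve (n ∷ k ∷ b₁ ∷ []))

      -- The hypothesis `2a ≤ k + c₂` keeps `b₁` linear in `k`; through `b₁-small` so is `c₂`.
      k-2≤3b₁ : k - + 2 ≤ + 3 * b₁
      k-2≤3b₁ =
        let e = gap 2a≤ ⊕ gap c₂≤b₁
        in by-difference e (solve (k ∷ b₁ ∷ c₂ ∷ []))

      k≤4b₁ : k ≤ + 4 * b₁
      k≤4b₁ = ≤-by-contradiction {k} {+ 4 * b₁} λ p →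
        let e = +-nonneg {4} ⊗ gap k-2≤3b₁ ⊕ +-nonneg {3} ⊗ gap p ⊕ gap 14≤k
        in impossible e 8 (solve (k ∷ b₁ ∷ []))

      b₁≤2c₂ : b₁ ≤ + 2 * c₂
      b₁≤2c₂ =
        let e = gap b₁-small ⊕ 0≤c₂
        in cancel-positive {n} {b₁} {+ 2 * c₂} 1≤n (by-difference e (solve (n ∷ b₁ ∷ c₂ ∷ [])))

      k≤7c₂ : k ≤ + 7 * c₂
      k≤7c₂ = ≤-by-contradiction {k} {+ 7 * c₂} λ p →
        let e = +-nonneg {7} ⊗ (+-nonneg {3} ⊗ gap b₁≤2c₂ ⊕ gap k-2≤3b₁) ⊕ +-nonneg {6} ⊗ gap p ⊕ gap 14≤k
        in impossible e 5 (solve (k ∷ b₁ ∷ c₂ ∷ []))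

      1≤c₂ : 1ℤ ≤ c₂
      1≤c₂ = ≤-by-contradiction {1ℤ} {c₂} λ p →
        let e = gap k≤7c₂ ⊕ gap 14≤k ⊕ +-nonneg {7} ⊗ gap p
        in impossible e 13 (solve (k ∷ c₂ ∷ []))

      k₂≤2k : k₂ ≤ + 2 * k
      k₂≤2k =
        let e = gap k₂-small ⊕ 0≤k
        in cancel-positive {n} {k₂} {+ 2 * k} 1≤n (by-difference e (solve (n ∷ k ∷ k₂ ∷ [])))

      c₂≤k : c₂ ≤ k
      c₂≤k =
        let e = gap c₂≤b₁ ⊕ 0≤a ⊕ +-nonneg {1}
        in by-difference e (solve (k ∷ b₁ ∷ c₂ ∷ []))

      -- Here `m` stands for the size of a third sphere; 14 is 2 from `k₂≤2k` times 7 from `k≤7c₂`.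
      m≤14b₂ : ∀ {b₂ c₃ m} → 0ℤ ≤ b₂ → 0ℤ ≤ m → c₂ ≤ c₃ → m * c₃ ≡ k₂ * b₂ → m ≤ + 14 * b₂
      m≤14b₂ {b₂} {c₃} {m} 0≤b₂ 0≤m c₂≤c₃ mc₃ =
        let e = +-nonneg {7} ⊗ (gap k₂≤2k ⊗ 0≤b₂ ⊕ gap (ℤₚ.≤-reflexive mc₃))
                ⊕ 0≤m ⊗ (+-nonneg {7} ⊗ gap c₂≤c₃ ⊕ gap k≤7c₂)
        in cancel-positive {k} {m} {+ 14 * b₂} 1≤k (by-difference e (solve (k ∷ c₂ ∷ k₂ ∷ b₂ ∷ c₃ ∷ m ∷ [])))

      0≤6na+k : 0ℤ ≤ + 6 * n * (k - 1ℤ - b₁) + k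
      0≤6na+k = +-nonneg {6} ⊗ 0≤n ⊗ 0≤a ⊕ 0≤k

      1≤kk : 1ℤ ≤ k * k
      1≤kk =
        let e = 0≤k ⊗ gap 1≤k ⊕ gap 1≤k
        in by-difference e (solve (k ∷ []))

      module _ {l x : ℤ} (0≤l : 0ℤ ≤ l) (0≤x : 0ℤ ≤ x) where

        -- The bounds `k ≤ 4b₁` and `k₂ ≤ 2k` already give `12k²`; the weaker `36nk²` is the form
        -- shared with `spread-coclique`.
        spread-clique : l * b₁ * x ≤ k * k * (k + k₂) → l * x ≤ + 36 * n * (k * k)
        spread-clique h =
          let e = +-nonneg {4} ⊗ gap h ⊕ +-nonneg {4} ⊗ (square-nonneg k) ⊗ gap k₂≤2k ⊕ 0≤l ⊗ 0≤x ⊗ gap k≤4b₁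
                  ⊕ 0≤k ⊗ square-nonneg k ⊗ (+-nonneg {36} ⊗ gap 1≤n ⊕ +-nonneg {24})
          in cancel-positive {k} {l * x} {+ 36 * n * (k * k)} 1≤k
               (by-difference e (solve (n ∷ k ∷ b₁ ∷ k₂ ∷ l ∷ x ∷ [])))

        module _ {b₂ : ℤ} (0≤b₂ : 0ℤ ≤ b₂) (6480n³≤l : + 6480 * (n * n * n) ≤ l) where

          spread-b₂ : l * b₂ * ((k - 1ℤ - b₁ - 0ℤ) * (k - 1ℤ - b₁ - 0ℤ)) ≤ k * k * (k + + 14 * k) →
                      l * b₂ ≤ + 540 * (n * n) * k
          spread-b₂ h =
            let e = +-nonneg {36} ⊗ square-nonneg n ⊗ gap h ⊕ 0≤l ⊗ 0≤b₂ ⊗ (gap k≤6na ⊗ 0≤6na+k)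
            in cancel-positive {k * k} {l * b₂} {+ 540 * (n * n) * k} 1≤kk
                 (by-difference e (solve (n ∷ k ∷ b₁ ∷ l ∷ b₂ ∷ [])))

          -- From `c₂ ≤ b₁`, the right factor is at least `a + 1 - b₂` with `a ≥ k/(6n)`. As 6480 =
          -- 12 · 540, the size of `l` gives `b₂ ≤ k/(12n)`, so half of the bound on `a` survives.
          k≤12na₂ : 1ℤ ≤ l → l * b₂ ≤ + 540 * (n * n) * k → k ≤ + 12 * n * (k - c₂ - b₂)
          k≤12na₂ 1≤l h =
            let e = +-nonneg {12} ⊗ 0≤n ⊗ 0≤l ⊗ gap c₂≤b₁ ⊕ +-nonneg {12} ⊗ 0≤n ⊗ 0≤l ⊕ +-nonneg {2} ⊗ 0≤l ⊗ gap k≤6na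
                    ⊕ +-nonneg {12} ⊗ 0≤n ⊗ gap h ⊕ 0≤k ⊗ gap 6480n³≤l
            in cancel-positive {l} {k} {+ 12 * n * (k - c₂ - b₂)} 1≤l
                 (by-difference e (solve (n ∷ k ∷ b₁ ∷ c₂ ∷ l ∷ b₂ ∷ [])))

          spread-coclique : k ≤ + 12 * n * (k - c₂ - b₂) → l * (k - c₂ - b₂) * x ≤ k * k * (k + k₂) → l * x ≤ + 36 * n * (k * k)
          spread-coclique q h =
            let e = +-nonneg {12} ⊗ 0≤n ⊗ gap h ⊕ +-nonneg {12} ⊗ 0≤n ⊗ square-nonneg k ⊗ gap k₂≤2k ⊕ 0≤l ⊗ 0≤x ⊗ gap q
            in cancel-positive {k} {l * x} {+ 36 * n * (k * k)} 1≤k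
                 (by-difference e (solve (n ∷ k ∷ c₂ ∷ k₂ ∷ l ∷ x ∷ b₂ ∷ [])))

      spread⇒close : ∀ {l t g} → + 36 * n * (t * t) ≤ l → l * (g * g) ≤ + 36 * n * (k * k) → t * g ≤ k
      spread⇒close {l} {t} {g} 36nt²≤l h = square-cancel-≤ {t * g} {k} 0≤k
        (let e = gap h ⊕ square-nonneg g ⊗ gap 36nt²≤l
             f = +-nonneg {36} ⊗ gap 1≤n ⊕ +-nonneg {35}
         in cancel-positive {+ 36 * n} {t * g * (t * g)} {k * k}
              (by-difference f (solve (n ∷ [])))
              (by-difference e (solve (n ∷ k ∷ l ∷ t ∷ g ∷ []))))

      module _ {e b₂ : ℤ} (0≤e : 0ℤ ≤ e) (0≤b₂ : 0ℤ ≤ b₂) (e-small : + 144 * (n * n) * e ≤ k)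
               (k-large : + 1008 * (n * n) + + 7 ≤ k) where

        144n²<c₂ : + 144 * (n * n) + 1ℤ ≤ c₂
        144n²<c₂ =
          let p = gap k≤7c₂ ⊕ gap k-large
          in cancel-positive {+ 7} {+ 144 * (n * n) + 1ℤ} {c₂} (+≤+ (s≤s z≤n)) (by-difference p (solve (n ∷ k ∷ c₂ ∷ [])))

        -- With `a ≥ k/(6n)` the hypothesis becomes `b₂c₂k ≤ 36n²(k(b₂ + c₂) + 2b₂c₂e)`. The term in
        -- `e` is at most half of the left side by `e-small`; the term in `b₂` is at most half of
        -- what remains because `c₂` exceeds `144n²`.
        b₂≤144n² : b₂ * c₂ * ((0ℤ - (k - 1ℤ - b₁)) * (0ℤ - (k - 1ℤ - b₁)))
                     ≤ k * (k * (b₂ + c₂) + + 2 * (b₂ * c₂) * (c₂ + e - c₂)) →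
                   b₂ ≤ + 144 * (n * n)
        b₂≤144n² h =
          let p = +-nonneg {36} ⊗ square-nonneg n ⊗ gap h ⊕ 0≤b₂ ⊗ 0≤c₂ ⊗ (gap k≤6na ⊗ 0≤6na+k)
              q = cancel-positive {k} {b₂ * c₂ * k} {+ 36 * (n * n) * (k * (b₂ + c₂) + + 2 * (b₂ * c₂) * e)} 1≤k
                    (by-difference p (solve (n ∷ k ∷ b₁ ∷ c₂ ∷ e ∷ b₂ ∷ [])))
              r = +-nonneg {4} ⊗ gap q ⊕ +-nonneg {2} ⊗ (0≤b₂ ⊗ 0≤c₂) ⊗ gap e-small
                  ⊕ 0≤k ⊗ 0≤b₂ ⊗ (gap 144n²<c₂ ⊕ +-nonneg {1})
              s = cancel-positive {k} {c₂ * b₂} {c₂ * (+ 144 * (n * n))} 1≤k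
                    (by-difference r (solve (n ∷ k ∷ c₂ ∷ e ∷ b₂ ∷ [])))
          in cancel-positive {c₂} {b₂} {+ 144 * (n * n)} 1≤c₂ s

      module _ {e b₂ c₃ m B : ℤ} (0≤e : 0ℤ ≤ e) (0≤m : 0ℤ ≤ m) (0≤c₃ : 0ℤ ≤ c₃)
               (a≤c₂+e : k - 1ℤ - b₁ ≤ c₂ + e) (c₂-e≤a : c₂ - e ≤ k - 1ℤ - b₁)
               (mc₃ : m * c₃ ≡ k₂ * b₂) (m≤14b₂ : m ≤ + 14 * b₂) (k-c₃<m : k - c₃ + 1ℤ ≤ m) (c₃≤k : c₃ ≤ k) where

        -- Multiply by `c₃` and substitute `m * c₃ = k₂ * b₂` and `k₂ * c₂ = k * b₁`. Replacing `c₃`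
        -- by `k` costs terms in `m`, replacing `b₁` by `k - c₂` costs terms in `e`; then `k`
        -- cancels.
        b₂-relation : 1ℤ ≤ b₂ → c₃ * b₂ ≤ (c₂ + e) * m + (c₃ - (c₂ + e)) →
          (b₂ + 1ℤ) * c₂ ≤ k + + 2 * b₂ * m + + 3 * b₂ * e
        b₂-relation 1≤b₂ h =
          let 0≤b₂ = ℤₚ.≤-trans (+-nonneg {1}) 1≤b₂
              p = 0≤c₃ ⊗ gap h
                  ⊕ (0≤c₂ ⊕ 0≤e) ⊗ gap (ℤₚ.≤-reflexive mc₃)
                  ⊕ 0≤b₂ ⊗ gap (ℤₚ.≤-reflexive k₂c₂)
                  ⊕ 0≤k ⊗ 0≤b₂ ⊗ gap c₂-e≤a
                  ⊕ 0≤e ⊗ 0≤b₂ ⊗ gap k₂≤2k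
                  ⊕ gap 1≤b₂ ⊗ ((gap k-c₃<m ⊕ +-nonneg {1}) ⊗ (0≤k ⊕ 0≤c₃) ⊕ 0≤m ⊗ gap c₃≤k)
                  ⊕ 0≤c₂ ⊗ (gap k-c₃<m ⊕ +-nonneg {1}) ⊕ 0≤m ⊗ gap c₂≤k
                  ⊕ 0≤c₃ ⊗ 0≤e ⊕ 0≤k ⊗ 0≤b₂ ⊕ 0≤m ⊗ 0≤k
          in cancel-positive {k} {(b₂ + 1ℤ) * c₂} {k + + 2 * b₂ * m + + 3 * b₂ * e} 1≤k
               (by-difference p (solve (k ∷ b₁ ∷ c₂ ∷ k₂ ∷ e ∷ b₂ ∷ c₃ ∷ m ∷ [])))

        -- For `a` within `e` of `c₂`, `b₁-small` pushes `3c₂` above `k` by a margin linear in `k`,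
        -- while `b₂ ≥ 2` in `b₂-relation` bounds `3c₂` by `k` plus lower-order terms. Each of the
        -- two largeness hypotheses absorbs half of the margin.
        b₂≤1 : b₂ ≤ B → (+ 6 * n + + 18 * n * B) * e ≤ k → + 168 * n * (B * B) + + 6 * n + 1ℤ ≤ k →
          c₃ * b₂ ≤ (c₂ + e) * m + (c₃ - (c₂ + e)) → b₂ ≤ 1ℤ
        b₂≤1 b₂≤B e-small k-large h = ≤-by-contradiction {b₂} {1ℤ} λ 2≤b₂ →
          let 0≤b₂ = ℤₚ.≤-trans (+-nonneg {2}) 2≤b₂
              0≤B  = ℤₚ.≤-trans 0≤b₂ b₂≤B
              1≤b₂ = ℤₚ.≤-trans (ℤₚ.i≤i+j 1ℤ (+ 1)) 2≤b₂
              -- 3 c₂ ≤ k + 28 B² + 3 B e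
              p = gap (b₂-relation 1≤b₂ h) ⊕ gap 2≤b₂ ⊗ 0≤c₂
                  ⊕ +-nonneg {2} ⊗ 0≤b₂ ⊗ gap m≤14b₂ ⊕ +-nonneg {28} ⊗ (gap b₂≤B ⊗ (0≤B ⊕ 0≤b₂))
                  ⊕ +-nonneg {3} ⊗ 0≤e ⊗ gap b₂≤B
              q = gap b₁-small ⊕ 0≤n ⊗ gap a≤c₂+e
              r = +-nonneg {2} ⊗ (+-nonneg {3} ⊗ q ⊕ (gap 1≤n ⊕ +-nonneg {2} ⊗ 0≤n) ⊗ p
                    ⊕ (+-nonneg {28} ⊗ square-nonneg B ⊕ +-nonneg {3} ⊗ 0≤B ⊗ 0≤e))
                  ⊕ gap e-small ⊕ gap k-large
          in impossible r 0 (solve (n ∷ k ∷ b₁ ∷ c₂ ∷ e ∷ b₂ ∷ m ∷ B ∷ []))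

        -- Since `c₃` is within a constant of `k`, `m ≥ 2` would make `k₂` at least `2k` minus a
        -- constant, exceeding `(2 - 1/n)k`.
        m≤1 : m * c₃ ≡ k₂ → m ≤ + 14 → + 28 * n + 1ℤ ≤ k → m ≤ 1ℤ
        m≤1 mc₃≡k₂ m≤14 k-large = ≤-by-contradiction {m} {1ℤ} λ 2≤m →
          let p = gap k₂-small ⊕ 0≤n ⊗ gap (ℤₚ.≤-reflexive mc₃≡k₂) ⊕ 0≤n ⊗ 0≤c₃ ⊗ gap 2≤m
                  ⊕ +-nonneg {2} ⊗ 0≤n ⊗ (gap k-c₃<m ⊕ gap m≤14) ⊕ gap k-large ⊕ +-nonneg {2} ⊗ 0≤n
          in impossible p 0 (solve (n ∷ k ∷ k₂ ∷ c₃ ∷ m ∷ []))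

  -- Ramsey's theorem for two colours on lists

  open import Data.List.Relation.Binary.Sublist.Propositional using (_⊆_; []; _∷_; _∷ʳ_; ⊆-trans; minimum)
  open import Data.List.Relation.Unary.All as All using (All; []; _∷_)
  open import Data.List.Relation.Unary.AllPairs using (AllPairs; []; _∷_)

  module _ {A : Set} where

    AllPairs-resp-⊆ : ∀ {R : A → A → Set} {xs ys} → xs ⊆ ys → AllPairs R ys → AllPairs R xs
    AllPairs-resp-⊆ []         []       = []
    AllPairs-resp-⊆ (_ ∷ʳ s)   (_ ∷ ps) = AllPairs-resp-⊆ s ps
    AllPairs-resp-⊆ (refl ∷ s) (p ∷ ps) = All-resp-⊆ s p ∷ AllPairs-resp-⊆ s ps

    AllPairs-lookup : ∀ {R : A → A → Set} → (∀ {x y} → R x y → R y x) → ∀ {xs} → AllPairs R xs →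
                      ∀ i j → i ≢ j → R (lookup xs i) (lookup xs j)
    AllPairs-lookup R-sym (p ∷ ps) zero    zero    i≢j = ⊥-elim (i≢j refl)
    AllPairs-lookup R-sym (p ∷ ps) zero    (suc j) i≢j = All.lookup p (∈-lookup j)
    AllPairs-lookup R-sym (p ∷ ps) (suc i) zero    i≢j = R-sym (All.lookup p (∈-lookup i))
    AllPairs-lookup R-sym (p ∷ ps) (suc i) (suc j) i≢j = AllPairs-lookup R-sym ps i j λ { refl → i≢j refl }

    All-⊎-split : ∀ {P Q : A → Set} {xs} → All (λ x → P x ⊎ Q x) xs →
      ∃[ ys ] ∃[ zs ] ys ⊆ xs × zs ⊆ xs × All P ys × All Q zs × length ys ℕ.+ length zs ≡ length xs
    All-⊎-split [] = [] , [] , [] , [] , [] , [] , refl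
    All-⊎-split (inj₁ p ∷ ps) with All-⊎-split ps
    ... | ys , zs , s , t , Py , Qz , eq = _ ∷ ys , zs , refl ∷ s , _ ∷ʳ t , p ∷ Py , Qz , cong suc eq
    All-⊎-split (inj₂ q ∷ ps) with All-⊎-split ps
    ... | ys , zs , s , t , Py , Qz , eq =
      ys , _ ∷ zs , _ ∷ʳ s , refl ∷ t , Py , q ∷ Qz , trans (ℕₚ.+-suc _ _) (cong suc eq)

    -- The tail is split by its colour to the head, and one class has at least half the required
    -- length: if the `R` class misses `2 ^ (p + suc q)`, it does so by at least one, which pays for
    -- the head itself.
    ramsey : ∀ {R S : A → A → Set} p q {xs} → AllPairs (λ x y → R x y ⊎ S x y) xs → 2 ℕ.^ (p ℕ.+ q) ℕ.≤ length xs →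
      (∃[ ys ] ys ⊆ xs × AllPairs R ys × length ys ≡ p) ⊎ (∃[ ys ] ys ⊆ xs × AllPairs S ys × length ys ≡ q)
    ramsey zero    q       _ _ = inj₁ ([] , minimum _ , [] , refl)
    ramsey (suc p) zero    _ _ = inj₂ ([] , minimum _ , [] , refl)
    ramsey (suc p) (suc q) {[]} [] large = ⊥-elim (ℕₚ.<⇒≱ (ℕₚ.m^n>0 2 (suc p ℕ.+ suc q)) large)
    ramsey (suc p) (suc q) {x ∷ xs} (c ∷ cs) large with All-⊎-split c
    ... | ys , zs , ys⊆ , zs⊆ , Rys , Szs , eq with 2 ℕ.^ (p ℕ.+ suc q) ℕₚ.≤? length ys
    ...   | yes big with ramsey p (suc q) (AllPairs-resp-⊆ ys⊆ cs) big
    ...     | inj₁ (ws , ws⊆ , Rws , len) =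
              inj₁ (x ∷ ws , refl ∷ ⊆-trans ws⊆ ys⊆ , All-resp-⊆ ws⊆ Rys ∷ Rws , cong suc len)
    ...     | inj₂ (ws , ws⊆ , Sws , len) = inj₂ (ws , x ∷ʳ ⊆-trans ws⊆ ys⊆ , Sws , len)
    ramsey (suc p) (suc q) {x ∷ xs} (c ∷ cs) large
        | ys , zs , ys⊆ , zs⊆ , Rys , Szs , eq | no small
        with ramsey (suc p) q (AllPairs-resp-⊆ zs⊆ cs) (ℕₚ.+-cancelˡ-≤ (suc (length ys)) _ _ (begin
          suc (length ys) ℕ.+ 2 ℕ.^ (suc p ℕ.+ q)       ≤⟨ ℕₚ.+-monoˡ-≤ _ (ℕₚ.≰⇒> small) ⟩
          2 ℕ.^ (p ℕ.+ suc q) ℕ.+ 2 ℕ.^ (suc p ℕ.+ q)   ≡⟨ cong (λ e → 2 ℕ.^ (p ℕ.+ suc q) ℕ.+ 2 ℕ.^ e) (sym (ℕₚ.+-suc p q)) ⟩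
          2 ℕ.^ (p ℕ.+ suc q) ℕ.+ 2 ℕ.^ (p ℕ.+ suc q)   ≡⟨ cong (2 ℕ.^ (p ℕ.+ suc q) ℕ.+_) (sym (ℕₚ.+-identityʳ _)) ⟩
          2 ℕ.^ (suc p ℕ.+ suc q)                       ≤⟨ large ⟩
          suc (length xs)                               ≡⟨ cong suc eq ⟨
          suc (length ys) ℕ.+ length zs                 ∎))
        where open ℕₚ.≤-Reasoning
    ...     | inj₁ (ws , ws⊆ , Rws , len) = inj₁ (ws , x ∷ʳ ⊆-trans ws⊆ zs⊆ , Rws , len)
    ...     | inj₂ (ws , ws⊆ , Sws , len) =
              inj₂ (x ∷ ws , refl ∷ ⊆-trans ws⊆ zs⊆ , All-resp-⊆ ws⊆ Szs ∷ Sws , cong suc len)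

  ∑-const : ∀ n x → ∑ {n} (λ _ → x) ≡ + n * x
  ∑-const zero    x = trans (∑-cong {g = λ _ → 0ℤ} (λ ())) (trans (∑-zero 0) (sym (ℤₚ.*-zeroˡ x)))
  ∑-const (suc n) x = trans (∑-suc {n} (λ _ → x)) (trans (cong (λ t → x + t) (∑-const n x)) (sym (ℤₚ.suc-* (+ n) x)))

  -- Distance-regular graphs through indicator sums

  -- Counts are sums of products of indicators, so double counting is an exchange of sums. Indexing
  -- `count-c` by `suc i` avoids the truncated predecessor at distance 0.
  record DistanceRegular : Set where
    field
      n        : ℕ
      d        : Fin n → Fin n → ℕ
      d-refl   : ∀ x → d x x ≡ 0
      d-zero   : ∀ {x y} → d x y ≡ 0 → x ≡ y
      d-sym    : ∀ x y → d x y ≡ d y x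
      triangle : ∀ x y z → d x z ℕ.≤ d x y ℕ.+ d y z
      geodesic : ∀ i j {x z} → d x z ≡ i ℕ.+ j → ∃[ y ] d x y ≡ i × d y z ≡ j
      b c      : ℕ → ℕ
      count-c  : ∀ x y i → d x y ≡ suc i → ∑ (λ z → δ 1 (d y z) * δ i (d x z)) ≡ + c (suc i)
      count-b  : ∀ x y i → d x y ≡ i → ∑ (λ z → δ 1 (d y z) * δ (suc i) (d x z)) ≡ + b i

  module Counting (Γ : DistanceRegular) where
    open DistanceRegular Γ public

    V : Set
    V = Fin n

    S : ℕ → V → V → ℤ
    S i x y = δ i (d x y)

    k b₁ b₂ c₂ c₃ a₁ a₂ : ℤ
    k  = + b 0
    b₁ = + b 1
    b₂ = + b 2
    c₂ = + c 2
    c₃ = + c 3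
    a₁ = k - 1ℤ - b₁
    a₂ = k - c₂ - b₂

    ∣S∣ : ℕ → V → ℤ
    ∣S∣ i x = ∑ (S i x)

    common : V → V → ℤ
    common x y = S 1 x ∙ S 1 y

    S-sym : ∀ i x y → S i x y ≡ S i y x
    S-sym i x y = cong (δ i) (d-sym x y)

    S-disjoint : ∀ {i j} → i ≢ j → ∀ x y → S i x y * S j x y ≡ 0ℤ
    S-disjoint {i} {j} i≢j x y = trans
      (under-δ-≡ i (d x y) {S j x y} {0ℤ} (λ p → δ-0 λ q → i≢j (trans p (sym q)))) (ℤₚ.*-zeroʳ (S i x y))

    near-≤ : ∀ {x y z i j} → d x y ≡ i → d y z ≡ j → d x z ℕ.≤ i ℕ.+ j
    near-≤ {x} {y} {z} refl refl = triangle x y z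

    near-≥ : ∀ {x y z i j} → d x y ≡ i → d y z ≡ j → i ℕ.≤ d x z ℕ.+ j
    near-≥ {x} {y} {z} refl refl = subst (λ t → d x y ℕ.≤ d x z ℕ.+ t) (d-sym z y) (triangle x z y)

    step-cases : ∀ {x y z i} → d x y ≡ suc i → d y z ≡ 1 →
      d x z ≡ i ⊎ d x z ≡ suc i ⊎ d x z ≡ suc (suc i)
    step-cases {x} {y} {z} {i} p q = classify _ _
      (subst (d x z ℕ.≤_) (ℕₚ.+-comm (suc i) 1) (near-≤ p q))
      (subst (suc i ℕ.≤_) (ℕₚ.+-comm (d x z) 1) (near-≥ p q))
      where
      classify : ∀ m i → m ℕ.≤ suc (suc i) → suc i ℕ.≤ suc m → m ≡ i ⊎ m ≡ suc i ⊎ m ≡ suc (suc i)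
      classify zero    zero    _       _       = inj₁ refl
      classify zero    (suc i) _       (s≤s ())
      classify (suc zero)          zero _ _ = inj₂ (inj₁ refl)
      classify (suc (suc zero))    zero _ _ = inj₂ (inj₂ refl)
      classify (suc (suc (suc m))) zero (s≤s (s≤s ())) _
      classify (suc m) (suc i) (s≤s h) (s≤s h′) with classify m i h h′
      ... | inj₁ p        = inj₁ (cong suc p)
      ... | inj₂ (inj₁ p) = inj₂ (inj₁ (cong suc p))
      ... | inj₂ (inj₂ p) = inj₂ (inj₂ (cong suc p))

    degree : ∀ x → ∣S∣ 1 x ≡ k
    degree x = trans (∑-cong (λ z → sym (δ-idem 1 (d x z)))) (count-b x x 0 (d-refl x))

    ∣S∣-nonneg : ∀ i x → 0ℤ ≤ ∣S∣ i x
    ∣S∣-nonneg i x = ∑-nonneg (λ y → δ-nonneg i (d x y))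

    S-0 : ∀ x y → S 0 x y ≡ δ (toℕ x) (toℕ y)
    S-0 x y with δ-cases 0 (d x y)
    ... | inj₁ (p , q) = trans q (sym (δ-1 (cong toℕ (d-zero (sym p)))))
    ... | inj₂ (p , q) = trans q (sym (δ-0 λ e →
          p (sym (subst (λ z → d x z ≡ 0) (toℕ-injective e) (d-refl x)))))

    c₁≡1 : ∀ {x y} → d x y ≡ 1 → + c 1 ≡ 1ℤ
    c₁≡1 {x} {y} p = begin
      + c 1                                    ≡⟨ count-c x y 0 p ⟨
      ∑ (λ z → S 1 y z * S 0 x z)              ≡⟨ ∑-cong (λ z → trans (ℤₚ.*-comm (S 1 y z) _) (cong (_* S 1 y z) (S-0 x z))) ⟩
      ∑ (λ z → δ (toℕ x) (toℕ z) * S 1 y z)    ≡⟨ ∑-δ x (S 1 y) ⟩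
      S 1 y x                                  ≡⟨ δ-1 (sym (trans (d-sym y x) p)) ⟩
      1ℤ                                       ∎
      where open ≡-Reasoning

    -- A neighbour of `y` lies in one of the layers `i`, `i + 1`, `i + 2` around `x`; the outer two
    -- are counted by `c` and `b`.
    count-a : ∀ x y i → d x y ≡ suc i →
      ∑ (λ z → S 1 y z * S (suc i) x z) ≡ k - + c (suc i) - + b (suc i)
    count-a x y i p = begin
      ∑ (λ z → S 1 y z * S (suc i) x z)
        ≡⟨ ∑-cong (λ z → trans (under-δ-≡ 1 (d y z) (λ q → third (step-cases p (sym q))))
                         (expand (S 1 y z) (S i x z) (S (suc (suc i)) x z))) ⟩
      ∑ (combination terms)
        ≡⟨ ∑-combination terms ⟩
      combination-∑ terms
        ≡⟨ cong₂ _+_ (cong (1ℤ *_) (degree y)) (cong₂ _+_ (cong (- 1ℤ *_) (count-c x y i p))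
             (cong (λ t → - 1ℤ * t + 0ℤ) (count-b x y (suc i) p))) ⟩
      1ℤ * k + (- 1ℤ * + c (suc i) + (- 1ℤ * + b (suc i) + 0ℤ))
        ≡⟨ tidy k (+ c (suc i)) (+ b (suc i)) ⟩
      k - + c (suc i) - + b (suc i)
        ∎
      where
      open ≡-Reasoning
      terms : List (ℤ × (V → ℤ))
      terms = (1ℤ , S 1 y) ∷ (- 1ℤ , λ z → S 1 y z * S i x z) ∷ (- 1ℤ , λ z → S 1 y z * S (suc (suc i)) x z) ∷ []
      expand : ∀ u v w → u * (1ℤ - v - w) ≡ 1ℤ * u + (- 1ℤ * (u * v) + (- 1ℤ * (u * w) + 0ℤ))
      expand = solve-∀
      tidy : ∀ u v w → 1ℤ * u + (- 1ℤ * v + (- 1ℤ * w + 0ℤ)) ≡ u - v - w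
      tidy = solve-∀
      third : ∀ {m} → m ≡ i ⊎ m ≡ suc i ⊎ m ≡ suc (suc i) → δ (suc i) m ≡ 1ℤ - δ i m - δ (suc (suc i)) m
      third (inj₁ refl)
        rewrite δ-1 {i} refl | δ-0 {suc i} {i} ℕₚ.1+n≢n | δ-0 {suc (suc i)} {i} (ℕₚ.m+1+n≢n 1) = refl
      third (inj₂ (inj₁ refl))
        rewrite δ-1 {suc i} refl | δ-0 {i} {suc i} (ℕₚ.1+n≢n ∘ sym) | δ-0 {suc (suc i)} {suc i} ℕₚ.1+n≢n = refl
      third (inj₂ (inj₂ refl))
        rewrite δ-1 {suc (suc i)} refl | δ-0 {i} {suc (suc i)} (ℕₚ.m+1+n≢n 1 ∘ sym) | δ-0 {suc i} {suc (suc i)} (ℕₚ.1+n≢n ∘ sym) = refl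

    common-1 : ∀ {x y} → d x y ≡ 1 → common x y ≡ a₁
    common-1 {x} {y} p = trans (∑-cong (λ z → ℤₚ.*-comm (S 1 x z) (S 1 y z)))
      (trans (count-a x y 0 p) (cong (λ t → k - t - b₁) (c₁≡1 p)))

    common-2 : ∀ {x y} → d x y ≡ 2 → common x y ≡ c₂
    common-2 {x} {y} p = trans (∑-cong (λ z → ℤₚ.*-comm (S 1 x z) (S 1 y z))) (count-c x y 1 p)

    common-≥3 : ∀ {x y} → 3 ℕ.≤ d x y → common x y ≡ 0ℤ
    common-≥3 {x} {y} h = trans (∑-cong {g = λ _ → 0ℤ} (λ z →
      trans (under-δ-≡ 1 (d x z) {S 1 y z} {0ℤ} (λ p → δ-0 λ q →
        ℕₚ.<⇒≱ h (near-≤ (sym p) (trans (d-sym z y) (sym q)))))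
      (ℤₚ.*-zeroʳ (S 1 x z)))) (∑-zero n)

    common-sym : ∀ x y → common x y ≡ common y x
    common-sym x y = ∑-cong (λ z → ℤₚ.*-comm (S 1 x z) (S 1 y z))

    common-≤k : ∀ x y → common x y ≤ k
    common-≤k x y = subst (common x y ≤_) (degree x) (∑-mono λ z →
      ℤₚ.≤-trans (ℤₚ.*-monoˡ-≤-nonNeg (S 1 x z) {{nonNegative (δ-nonneg 1 (d x z))}} (δ-≤1 1 (d y z)))
                 (ℤₚ.≤-reflexive (ℤₚ.*-identityʳ (S 1 x z))))

    common-≤ : ∀ {M} → 0ℤ ≤ M → a₁ ≤ M → c₂ ≤ M → ∀ x y → x ≢ y → common x y ≤ M
    common-≤ 0≤M a≤M c≤M x y x≢y with d x y in eq
    ... | 0                 = ⊥-elim (x≢y (d-zero eq))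
    ... | 1                 = ℤₚ.≤-trans (ℤₚ.≤-reflexive (common-1 eq)) a≤M
    ... | 2                 = ℤₚ.≤-trans (ℤₚ.≤-reflexive (common-2 eq)) c≤M
    ... | suc (suc (suc m)) = ℤₚ.≤-trans (ℤₚ.≤-reflexive (common-≥3 (subst (3 ℕ.≤_) (sym eq) (s≤s (s≤s (s≤s z≤n)))))) 0≤M

    -- Both sides count the edges between the layers `i` and `i + 1` around `x`.
    handshake : ∀ i x → ∣S∣ (suc i) x * + c (suc i) ≡ ∣S∣ i x * + b i
    handshake i x = begin
      ∣S∣ (suc i) x * + c (suc i)
        ≡⟨ trans (ℤₚ.*-comm (∣S∣ (suc i) x) _) (sym (∑-* (+ c (suc i)) (S (suc i) x))) ⟩
      ∑ (λ s → + c (suc i) * S (suc i) x s)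
        ≡⟨ ∑-cong (λ s → trans (ℤₚ.*-comm (+ c (suc i)) _) (under-δ-≡ (suc i) (d x s) λ p → sym (count-c x s i (sym p)))) ⟩
      ∑ (λ s → S (suc i) x s * ∑ (λ w → S 1 s w * S i x w))
        ≡⟨ ∑-cong (λ s → sym (∑-* (S (suc i) x s) _)) ⟩
      ∑ (λ s → ∑ (λ w → S (suc i) x s * (S 1 s w * S i x w)))
        ≡⟨ ∑-swap _ ⟩
      ∑ (λ w → ∑ (λ s → S (suc i) x s * (S 1 s w * S i x w)))
        ≡⟨ ∑-cong (λ w → ∑-cong (λ s → trans (cong (λ t → S (suc i) x s * (t * S i x w)) (S-sym 1 s w))
             (reorder (S (suc i) x s) (S 1 w s) (S i x w)))) ⟩
      ∑ (λ w → ∑ (λ s → S i x w * (S 1 w s * S (suc i) x s)))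
        ≡⟨ ∑-cong (λ w → ∑-* (S i x w) _) ⟩
      ∑ (λ w → S i x w * ∑ (λ s → S 1 w s * S (suc i) x s))
        ≡⟨ ∑-cong (λ w → trans (under-δ-≡ i (d x w) λ p → count-b x w i (sym p)) (ℤₚ.*-comm (S i x w) (+ b i))) ⟩
      ∑ (λ w → + b i * S i x w)
        ≡⟨ trans (∑-* (+ b i) (S i x)) (ℤₚ.*-comm (+ b i) _) ⟩
      ∣S∣ i x * + b i
        ∎
      where
      open ≡-Reasoning
      reorder : ∀ u v w → u * (v * w) ≡ w * (v * u)
      reorder = solve-∀

    module _ {x y z : V} {i : ℕ} (xy : d x y ≡ i) (yz : d y z ≡ 2) (xz : d x z ≡ i ℕ.+ 2) where

      private
        common-layer : ∀ {s} → d y s ≡ 1 → d z s ≡ 1 → d x s ≡ suc i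
        common-layer {s} p q = ℕₚ.≤-antisym
          (subst (d x s ℕ.≤_) (ℕₚ.+-comm i 1) (near-≤ xy p))
          (ℕₚ.+-cancelʳ-≤ 1 (suc i) (d x s) (subst (ℕ._≤ d x s ℕ.+ 1)
            (trans xz (trans (ℕₚ.+-suc i 1) refl)) (near-≤ refl (trans (d-sym s z) q))))

      -- On a geodesic through `y`, every common neighbour of `y` and `z` lies in the layer `i + 1`
      -- around `x`, hence among the outward neighbours of `y`. The next lemma views the same set
      -- from `z`.
      c₂≤b : c₂ ≤ + b i
      c₂≤b = subst₂ _≤_ (common-2 yz) (count-b x y i xy)
        (∑-mono λ s → under-δ-≤ 1 (d y s) λ p → ≤δ (λ q → common-layer (sym p) q))
        where
        ≤δ : ∀ {s} → (d z s ≡ 1 → d x s ≡ suc i) → S 1 z s ≤ S (suc i) x s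
        ≤δ {s} h with δ-cases 1 (d z s)
        ... | inj₁ (q , e) = ℤₚ.≤-reflexive (trans e (sym (δ-1 (sym (h (sym q))))))
        ... | inj₂ (_ , e) = subst (_≤ S (suc i) x s) (sym e) (δ-nonneg (suc i) (d x s))

      c₂≤c : c₂ ≤ + c (suc (suc i))
      c₂≤c = subst₂ _≤_ (trans (common-sym z y) (common-2 yz)) (count-c x z (suc i) (trans xz (ℕₚ.+-comm i 2)))
        (∑-mono λ s → under-δ-≤ 1 (d z s) λ p → ≤δ (λ q → common-layer q (sym p)))
        where
        ≤δ : ∀ {s} → (d y s ≡ 1 → d x s ≡ suc i) → S 1 y s ≤ S (suc i) x s
        ≤δ {s} h with δ-cases 1 (d y s)
        ... | inj₁ (q , e) = ℤₚ.≤-reflexive (trans e (sym (δ-1 (sym (h (sym q))))))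
        ... | inj₂ (_ , e) = subst (_≤ S (suc i) x s) (sym e) (δ-nonneg (suc i) (d x s))

    a-nonneg : ∀ {x y i} → d x y ≡ suc i → 0ℤ ≤ k - + c (suc i) - + b (suc i)
    a-nonneg {x} {y} {i} p = subst (0ℤ ≤_) (count-a x y i p)
      (∑-nonneg λ z → δ-nonneg 1 (d y z) ⊗ δ-nonneg (suc i) (d x z))

  -- Families of vertices at constant distance

  module Configurations (Γ : DistanceRegular) where
    open Counting Γ

    S-idem : ∀ i x y → S i x y * S i x y ≡ S i x y
    S-idem i x y = δ-idem i (d x y)

    S-nonneg : ∀ i x y → 0ℤ ≤ S i x y
    S-nonneg i x y = δ-nonneg i (d x y)

    S-≤1 : ∀ i x y → S i x y ≤ 1ℤ
    S-≤1 i x y = δ-≤1 i (d x y)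

    -- Summing r(1 - p)(1 - q) + (1 - r)pq ≥ 0 over the adjacency bits r, p, q to u, x, y.
    common-+-≤ : ∀ u x y → common u x + common u y ≤ k + common x y
    common-+-≤ u x y = begin
      common u x + common u y                                    ≡⟨ ∑-+ _ _ ⟨
      ∑ (λ s → S 1 u s * S 1 x s + S 1 u s * S 1 y s)            ≤⟨ ∑-mono (λ s → by-difference
        (S-nonneg 1 u s ⊗ (gap (S-≤1 1 x s) ⊗ gap (S-≤1 1 y s)) ⊕ gap (S-≤1 1 u s) ⊗ (S-nonneg 1 x s ⊗ S-nonneg 1 y s))
        (split (S 1 u s) (S 1 x s) (S 1 y s))) ⟩
      ∑ (λ s → S 1 u s + S 1 x s * S 1 y s)                      ≡⟨ ∑-+ (S 1 u) _ ⟩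
      ∣S∣ 1 u + common x y                                       ≡⟨ cong (_+ common x y) (degree u) ⟩
      k + common x y                                             ∎
      where
      open ℤₚ.≤-Reasoning
      split : ∀ r p q → r + p * q - (r * p + r * q) ≡ r * ((1ℤ - p) * (1ℤ - q)) + (1ℤ - r) * (p * q)
      split = solve-∀

    2a₁≤k+c₂ : ∀ {x y} → d x y ≡ 2 → a₁ + a₁ ≤ k + c₂
    2a₁≤k+c₂ {x} {y} xy with u , xu , uy ← geodesic 1 1 xy =
      subst₂ _≤_ (cong₂ _+_ (common-1 (trans (d-sym u x) xu)) (common-1 uy)) (cong (λ t → k + t) (common-2 xy))
        (common-+-≤ u x y)

    -- For each vertex `w` the blocks are the members adjacent to `w`, with `a₁` common neighbours,
    -- and those at distance `e` from it, with `h`. Every pair of members has the same `M`, so the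
    -- loss term is zero.
    module Homogeneous {l t e : ℕ} {M h R K : ℤ} (X : Fin (suc l) → V) (1≤k : 1ℤ ≤ k) (0≤M : 0ℤ ≤ M)
      (1≢e : 1 ≢ e) (apart : ∀ i j → i ≢ j → d (X i) (X j) ≡ t)
      (common-t : ∀ {x y} → d x y ≡ t → common x y ≡ M)
      (common-e : ∀ {x y} → d x y ≡ e → common x y ≡ h)
      (count-t : ∀ {x y} → d x y ≡ t → ∑ (λ w → S 1 x w * S e y w) ≡ R)
      (∣S∣-e : ∀ x → ∣S∣ e x ≤ K)
      where

      private
        p q : V → ℤ
        p w = ∑ (λ i → S 1 (X i) w)
        q w = ∑ (λ i → S e (X i) w)

        κ : Fin (suc l) → Fin (suc l) → ℤ
        κ i j = δ (toℕ j) (toℕ i)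

        gram-≡ : ∀ i j → i ≢ j → common (X i) (X j) ≡ M
        gram-≡ i j i≢j = common-t (apart i j i≢j)

        per-vertex : ∀ w → p w * q w * ((a₁ - h) * (a₁ - h)) ≤ k * (k * (p w + q w) + + 2 * (p w * q w) * 0ℤ)
        per-vertex w = subst (λ z → p w * q w * ((a₁ - h) * (a₁ - h)) ≤ k * (k * (p w + q w) + + 2 * (p w * q w) * z))
          (ℤₚ.i≡j⇒i-j≡0 {M} refl)
          (two-block-inequality k M M a₁ h (S 1 w) (λ i → S 1 (X i)) (λ i → S 1 (X i) w) (λ i → S e (X i) w)
            1≤k ℤₚ.≤-refl (trans (∑-cong (λ s → S-idem 1 w s)) (degree w))
            (λ i → S-nonneg 1 (X i) w) (λ i → S-idem 1 (X i) w)
            (λ i → S-nonneg e (X i) w) (λ i → S-idem e (X i) w)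
            upper lower
            (λ i → under-δ-≡ 1 (d (X i) w) λ r → common-1 (trans (d-sym w (X i)) (sym r)))
            (λ i → under-δ-≡ e (d (X i) w) λ r → common-e (trans (d-sym w (X i)) (sym r))))
          where
          upper : ∀ i j → common (X i) (X j) ≤ M + k * κ i j
          upper i j with δ-cases (toℕ j) (toℕ i)
          ... | inj₂ (ne , r) = ℤₚ.≤-reflexive (trans (gram-≡ i j (λ { refl → ne refl }))
                  (sym (trans (cong (λ z → M + k * z) r) (trans (cong (λ z → M + z) (ℤₚ.*-zeroʳ k)) (ℤₚ.+-identityʳ M)))))
          ... | inj₁ (eq , r) = by-difference (0≤M ⊕ gap (common-≤k (X i) (X j)))
                  (trans (cong (λ z → M + k * z - common (X i) (X j)) r) (rearrange M k (common (X i) (X j))))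
            where
            rearrange : ∀ M k x → M + k * 1ℤ - x ≡ M + (k - x)
            rearrange = solve-∀
          lower : ∀ i j → S 1 (X i) w * S e (X j) w * M ≤ S 1 (X i) w * S e (X j) w * common (X i) (X j)
          lower i j with δ-cases (toℕ j) (toℕ i)
          ... | inj₂ (ne , r) = ℤₚ.≤-reflexive (cong (S 1 (X i) w * S e (X j) w *_) (sym (gram-≡ i j (λ { refl → ne refl }))))
          ... | inj₁ (eq , r) = ℤₚ.≤-reflexive (trans (cong (_* M) vanish) (sym (cong (_* common (X i) (X j)) vanish)))
            where
            vanish : S 1 (X i) w * S e (X j) w ≡ 0ℤ
            vanish = trans (cong (λ z → S 1 (X i) w * S e (X z) w) (toℕ-injective eq)) (S-disjoint 1≢e (X i) w)

        L g² : ℤ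
        L  = + suc l
        g² = (a₁ - h) * (a₁ - h)

        pair-count : ∀ i j → ∑ (λ w → S 1 (X i) w * S e (X j) w) ≡ 1ℤ * R + (- R * (δ (toℕ i) (toℕ j) * 1ℤ) + 0ℤ)
        pair-count i j with δ-cases (toℕ i) (toℕ j)
        ... | inj₂ (ne , r) = trans (count-t (apart i j (λ { refl → ne refl })))
                (trans (off R) (cong (λ z → 1ℤ * R + (- R * (z * 1ℤ) + 0ℤ)) (sym r)))
          where
          off : ∀ R → R ≡ 1ℤ * R + (- R * (0ℤ * 1ℤ) + 0ℤ)
          off = solve-∀
        ... | inj₁ (eq , r) with refl ← toℕ-injective eq = trans (∑-cong {g = λ _ → 0ℤ} (S-disjoint 1≢e (X i)))
                (trans (∑-zero n) (trans (on R) (cong (λ z → 1ℤ * R + (- R * (z * 1ℤ) + 0ℤ)) (sym r))))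
          where
          on : ∀ R → 0ℤ ≡ 1ℤ * R + (- R * (1ℤ * 1ℤ) + 0ℤ)
          on = solve-∀

        ∑-pairs : ∑ (λ w → p w * q w) ≡ L * (+ l * R)
        ∑-pairs = begin
          ∑ (λ w → p w * q w)
            ≡⟨ ∑-cong (λ w → ∑-product (λ i → S 1 (X i) w) (λ j → S e (X j) w)) ⟨
          ∑ (λ w → ∑ (λ i → ∑ (λ j → S 1 (X i) w * S e (X j) w)))
            ≡⟨ ∑-swap _ ⟩
          ∑ (λ i → ∑ (λ w → ∑ (λ j → S 1 (X i) w * S e (X j) w)))
            ≡⟨ ∑-cong (λ i → ∑-swap _) ⟩
          ∑ (λ i → ∑ (λ j → ∑ (λ w → S 1 (X i) w * S e (X j) w)))
            ≡⟨ ∑-cong (λ i → ∑-cong (pair-count i)) ⟩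
          ∑ (λ i → ∑ (combination (row i)))
            ≡⟨ ∑-cong (λ i → trans (∑-combination (row i))
                 (cong₂ (λ u v → 1ℤ * u + (- R * v + 0ℤ)) (∑-const (suc l) R) (∑-δ i (λ _ → 1ℤ)))) ⟩
          ∑ {suc l} (λ i → 1ℤ * (L * R) + (- R * 1ℤ + 0ℤ))
            ≡⟨ ∑-const (suc l) _ ⟩
          L * (1ℤ * (L * R) + (- R * 1ℤ + 0ℤ))
            ≡⟨ cong (λ z → L * (1ℤ * (z * R) + (- R * 1ℤ + 0ℤ))) (ℤₚ.pos-+ 1 l) ⟩
          L * (1ℤ * ((1ℤ + + l) * R) + (- R * 1ℤ + 0ℤ))
            ≡⟨ tidy L (+ l) R ⟩
          L * (+ l * R)
            ∎
          where
          open ≡-Reasoning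
          row : Fin (suc l) → List (ℤ × (Fin (suc l) → ℤ))
          row i = (1ℤ , λ _ → R) ∷ (- R , λ j → δ (toℕ i) (toℕ j) * 1ℤ) ∷ []
          tidy : ∀ L m R → L * (1ℤ * ((1ℤ + m) * R) + (- R * 1ℤ + 0ℤ)) ≡ L * (m * R)
          tidy = solve-∀

        ∑-p : ∑ p ≡ L * k
        ∑-p = trans (∑-swap _) (trans (∑-cong (λ i → degree (X i))) (∑-const (suc l) k))

        ∑-q : ∑ q ≤ L * K
        ∑-q = ℤₚ.≤-trans (ℤₚ.≤-reflexive (∑-swap _))
          (ℤₚ.≤-trans (∑-mono (λ i → ∣S∣-e (X i))) (ℤₚ.≤-reflexive (∑-const (suc l) K)))

        summed : g² * (L * (+ l * R)) ≤ k * k * (L * k) + (k * k * (L * K) + 0ℤ)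
        summed = begin
          g² * (L * (+ l * R))                          ≡⟨ cong (g² *_) ∑-pairs ⟨
          g² * ∑ (λ w → p w * q w)                      ≡⟨ ∑-* g² _ ⟨
          ∑ (λ w → g² * (p w * q w))                    ≤⟨ ∑-mono (λ w → subst₂ _≤_ (ℤₚ.*-comm _ g²) (tidy k (p w) (q w)) (per-vertex w)) ⟩
          ∑ (combination ((k * k , p) ∷ (k * k , q) ∷ [])) ≡⟨ ∑-combination ((k * k , p) ∷ (k * k , q) ∷ []) ⟩
          k * k * ∑ p + (k * k * ∑ q + 0ℤ)              ≤⟨ ℤₚ.+-mono-≤ (ℤₚ.≤-reflexive (cong (k * k *_) ∑-p))
                                                            (ℤₚ.+-monoˡ-≤ 0ℤ (ℤₚ.*-monoˡ-≤-nonNeg (k * k) {{nonNegative (square-nonneg k)}} ∑-q)) ⟩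
          k * k * (L * k) + (k * k * (L * K) + 0ℤ)      ∎
          where
          open ℤₚ.≤-Reasoning
          tidy : ∀ k p q → k * (k * (p + q) + + 2 * (p * q) * 0ℤ) ≡ k * k * p + (k * k * q + 0ℤ)
          tidy = solve-∀

      -- `per-vertex` summed over `w`: each ordered pair of distinct members is counted `R` times,
      -- the linear terms give at most `(l + 1)(k + K)`, and one factor `l + 1` cancels. With `R` a
      -- fixed fraction and `K` a fixed multiple of `k`, a large `l` forces `a₁` close to `h`.
      spread-bound : + l * R * ((a₁ - h) * (a₁ - h)) ≤ k * k * (k + K)
      spread-bound = cancel-positive {L} {+ l * R * g²} {k * k * (k + K)} (+≤+ (s≤s z≤n))
        (subst₂ _≤_ (left g² L (+ l) R) (right k L K) summed)
        where
        left : ∀ g L m R → g * (L * (m * R)) ≡ L * (m * R * g)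
        left = solve-∀
        right : ∀ k L K → k * k * (L * k) + (k * k * (L * K) + 0ℤ) ≡ L * (k * k * (k + K))
        right = solve-∀

  -- Inequalities around the third sphere

  module Extremal (Γ : DistanceRegular) where
    open Counting Γ
    open Configurations Γ

    δδ-cases : ∀ i j i′ j′ → (i ≡ j × i′ ≡ j′) ⊎ δ i j * δ i′ j′ ≡ 0ℤ
    δδ-cases i j i′ j′ with δ-cases i j | δ-cases i′ j′
    ... | inj₁ (p , _) | inj₁ (q , _) = inj₁ (p , q)
    ... | inj₂ (_ , e) | _            = inj₂ (trans (cong (_* δ i′ j′) e) (ℤₚ.*-zeroˡ (δ i′ j′)))
    ... | inj₁ _       | inj₂ (_ , e) = inj₂ (trans (cong (δ i j *_) e) (ℤₚ.*-zeroʳ (δ i j)))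

    -- The blocks are the neighbours of y in the layers 3 and 1 around x, which are at distance 2 from each other.
    fan-inequality : ∀ {x y M} → d x y ≡ 2 → 1ℤ ≤ k → 0ℤ ≤ M → a₁ ≤ M → c₂ ≤ M →
      b₂ * c₂ * ((0ℤ - a₁) * (0ℤ - a₁)) ≤ k * (k * (b₂ + c₂) + + 2 * (b₂ * c₂) * (M - c₂))
    fan-inequality {x} {y} {M} xy 1≤k 0≤M a≤M c≤M =
      subst₂ (λ p q → p * q * ((0ℤ - a₁) * (0ℤ - a₁)) ≤ k * (k * (p + q) + + 2 * (p * q) * (M - c₂)))
        (count-b x y 2 xy) (count-c x y 1 xy)
        (two-block-inequality k M c₂ 0ℤ a₁ (S 1 x) (S 1) I J 1≤k c≤M (trans (∑-cong (S-idem 1 x)) (degree x))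
          (λ v → S-nonneg 1 y v ⊗ S-nonneg 3 x v) (λ v → idem (S-idem 1 y v) (S-idem 3 x v))
          (λ v → S-nonneg 1 y v ⊗ S-nonneg 1 x v) (λ v → idem (S-idem 1 y v) (S-idem 1 x v))
          gram cross far close)
      where
      I J : V → ℤ
      I v = S 1 y v * S 3 x v
      J v = S 1 y v * S 1 x v

      idem : ∀ {u v} → u * u ≡ u → v * v ≡ v → u * v * (u * v) ≡ u * v
      idem {u} {v} p q = trans (regroup u v) (cong₂ _*_ p q)
        where
        regroup : ∀ u v → u * v * (u * v) ≡ u * u * (v * v)
        regroup = solve-∀

      gram : ∀ u v → common u v ≤ M + k * δ (toℕ v) (toℕ u)
      gram u v with δ-cases (toℕ v) (toℕ u)
      ... | inj₂ (ne , r) = by-difference (gap (common-≤ 0≤M a≤M c≤M u v (λ { refl → ne refl })))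
            (trans (cong (λ z → M + k * z - common u v) r) (off M k (common u v)))
        where
        off : ∀ M k x → M + k * 0ℤ - x ≡ M - x
        off = solve-∀
      ... | inj₁ (_ , r) = by-difference (0≤M ⊕ gap (common-≤k u v))
            (trans (cong (λ z → M + k * z - common u v) r) (on M k (common u v)))
        where
        on : ∀ M k x → M + k * 1ℤ - x ≡ M + (k - x)
        on = solve-∀

      two : ∀ m → m ℕ.≤ 2 → 3 ℕ.≤ m ℕ.+ 1 → m ≡ 2
      two m h h′ = ℕₚ.≤-antisym h (ℕₚ.+-cancelʳ-≤ 1 2 m h′)

      cross : ∀ u v → I u * J v * c₂ ≤ I u * J v * common u v
      cross u v with δδ-cases 1 (d y u) 3 (d x u) | δδ-cases 1 (d y v) 1 (d x v)
      ... | inj₂ z       | _            = ℤₚ.≤-reflexive (trans (vanish c₂) (sym (vanish (common u v))))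
        where
        vanish : ∀ t → I u * J v * t ≡ 0ℤ
        vanish t = trans (cong (λ i → i * J v * t) z) (trans (cong (_* t) (ℤₚ.*-zeroˡ (J v))) (ℤₚ.*-zeroˡ t))
      ... | inj₁ _       | inj₂ z       = ℤₚ.≤-reflexive (trans (vanish c₂) (sym (vanish (common u v))))
        where
        vanish : ∀ t → I u * J v * t ≡ 0ℤ
        vanish t = trans (cong (λ j → I u * j * t) z) (trans (cong (_* t) (ℤₚ.*-zeroʳ (I u))) (ℤₚ.*-zeroˡ t))
      ... | inj₁ (yu , xu) | inj₁ (yv , xv) = ℤₚ.≤-reflexive (cong (I u * J v *_) (sym (common-2
            (two (d u v) (near-≤ (trans (d-sym u y) (sym yu)) (sym yv))
              (subst (λ t → 3 ℕ.≤ t ℕ.+ 1) (d-sym v u) (3≤ xu xv))))))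
        where
        3≤ : 3 ≡ d x u → 1 ≡ d x v → 3 ℕ.≤ d v u ℕ.+ 1
        3≤ p q = subst₂ ℕ._≤_ (sym p) (trans (cong (ℕ._+ d v u) (sym q)) (ℕₚ.+-comm 1 (d v u))) (triangle x v u)

      far : ∀ u → I u * common x u ≡ I u * 0ℤ
      far u with δδ-cases 1 (d y u) 3 (d x u)
      ... | inj₂ z        = trans (cong (_* common x u) z) (trans (ℤₚ.*-zeroˡ (common x u)) (sym (ℤₚ.*-zeroʳ (I u))))
      ... | inj₁ (_ , xu) = cong (I u *_) (common-≥3 (ℕₚ.≤-reflexive xu))

      close : ∀ v → J v * common x v ≡ J v * a₁
      close v with δδ-cases 1 (d y v) 1 (d x v)
      ... | inj₂ z        = trans (cong (_* common x v) z) (trans (ℤₚ.*-zeroˡ (common x v)) (sym (trans (cong (_* a₁) z) (ℤₚ.*-zeroˡ a₁))))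
      ... | inj₁ (_ , xv) = cong (J v *_) (common-1 (sym xv))

    -- Counts the paths z - y - z′ with y at distance 2 and z, z′ at distance 3 from x.
    antipode-count : ∀ {x z M} → d x z ≡ 3 → 0ℤ ≤ M → a₁ ≤ M → c₂ ≤ M →
      c₃ * b₂ ≤ M * ∣S∣ 3 x + (c₃ - M)
    antipode-count {x} {z} {M} xz 0≤M a≤M c≤M = begin
      c₃ * b₂
        ≡⟨ trans (ℤₚ.*-comm c₃ b₂) (cong (b₂ *_) (sym (count-c x z 2 xz))) ⟩
      b₂ * ∑ (λ y → S 1 z y * S 2 x y)
        ≡⟨ ∑-* b₂ _ ⟨
      ∑ (λ y → b₂ * (S 1 z y * S 2 x y))
        ≡⟨ ∑-cong (λ y → trans (rotate b₂ (S 1 z y) (S 2 x y)) (trans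
             (cong (S 1 z y *_) (under-δ-≡ 2 (d x y) (λ p → sym (count-b x y 2 (sym p)))))
             (sym (trans (∑-* (S 1 z y) _) (cong (S 1 z y *_) (∑-* (S 2 x y) _)))))) ⟩
      ∑ (λ y → ∑ (λ z′ → S 1 z y * (S 2 x y * (S 1 y z′ * S 3 x z′))))
        ≡⟨ ∑-swap _ ⟩
      ∑ (λ z′ → ∑ (λ y → S 1 z y * (S 2 x y * (S 1 y z′ * S 3 x z′))))
        ≡⟨ ∑-cong (λ z′ → trans (∑-cong (λ y → trans (cong (λ t → S 1 z y * (S 2 x y * (t * S 3 x z′))) (S-sym 1 y z′))
             (regroup (S 1 z y) (S 2 x y) (S 1 z′ y) (S 3 x z′)))) (∑-* (S 3 x z′) _)) ⟩
      ∑ (λ z′ → S 3 x z′ * paths z′)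
        ≤⟨ ∑-mono (λ z′ → under-δ-≤ 3 (d x z′) λ p → paths-≤ z′) ⟩
      ∑ (λ z′ → S 3 x z′ * (M + (c₃ - M) * δ (toℕ z) (toℕ z′)))
        ≡⟨ ∑-cong (λ z′ → expand (S 3 x z′) M (c₃ - M) (δ (toℕ z) (toℕ z′))) ⟩
      ∑ (combination ((M , S 3 x) ∷ (c₃ - M , λ z′ → δ (toℕ z) (toℕ z′) * S 3 x z′) ∷ []))
        ≡⟨ ∑-combination ((M , S 3 x) ∷ (c₃ - M , λ z′ → δ (toℕ z) (toℕ z′) * S 3 x z′) ∷ []) ⟩
      M * ∣S∣ 3 x + ((c₃ - M) * ∑ (λ z′ → δ (toℕ z) (toℕ z′) * S 3 x z′) + 0ℤ)
        ≡⟨ cong (λ t → M * ∣S∣ 3 x + ((c₃ - M) * t + 0ℤ)) (trans (∑-δ z (S 3 x)) (δ-1 (sym xz))) ⟩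
      M * ∣S∣ 3 x + ((c₃ - M) * 1ℤ + 0ℤ)
        ≡⟨ tidy (M * ∣S∣ 3 x) (c₃ - M) ⟩
      M * ∣S∣ 3 x + (c₃ - M)
        ∎
      where
      open ℤₚ.≤-Reasoning
      rotate : ∀ b u v → b * (u * v) ≡ u * (v * b)
      rotate = solve-∀
      regroup : ∀ u v w t → u * (v * (w * t)) ≡ t * (u * w * v)
      regroup = solve-∀
      expand : ∀ s M e t → s * (M + e * t) ≡ M * s + (e * (t * s) + 0ℤ)
      expand = solve-∀
      tidy : ∀ u e → u + (e * 1ℤ + 0ℤ) ≡ u + e
      tidy = solve-∀
      paths : V → ℤ
      paths z′ = ∑ (λ y → S 1 z y * S 1 z′ y * S 2 x y)
      paths-≤ : ∀ z′ → paths z′ ≤ M + (c₃ - M) * δ (toℕ z) (toℕ z′)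
      paths-≤ z′ with δ-cases (toℕ z) (toℕ z′)
      ... | inj₁ (eq , r) with refl ← toℕ-injective eq = ℤₚ.≤-reflexive (trans
            (trans (∑-cong (λ y → cong (_* S 2 x y) (S-idem 1 z y))) (count-c x z 2 xz))
            (trans (fill M c₃) (cong (λ t → M + (c₃ - M) * t) (sym r))))
        where
        fill : ∀ M e → e ≡ M + (e - M) * 1ℤ
        fill = solve-∀
      ... | inj₂ (ne , r) = ℤₚ.≤-trans
            (∑-mono {g = λ y → S 1 z y * S 1 z′ y} (λ y → subst (S 1 z y * S 1 z′ y * S 2 x y ≤_) (ℤₚ.*-identityʳ _)
              (ℤₚ.*-monoˡ-≤-nonNeg (S 1 z y * S 1 z′ y) {{nonNegative (S-nonneg 1 z y ⊗ S-nonneg 1 z′ y)}} (S-≤1 2 x y))))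
            (by-difference (gap (common-≤ 0≤M a≤M c≤M z z′ (λ { refl → ne refl })))
              (trans (cong (λ t → M + (c₃ - M) * t - common z z′) r) (empty M (c₃ - M) (common z z′))))
        where
        empty : ∀ M e u → M + e * 0ℤ - u ≡ M - u
        empty = solve-∀

    -- As `b 3` vanishes, `z` has `k - c₃` neighbours in its own layer; `z` itself is the additional
    -- 1.
    last-layer : (∀ x y → d x y ℕ.≤ 3) → ∀ {x z} → d x z ≡ 3 → k - c₃ + 1ℤ ≤ ∣S∣ 3 x
    last-layer diam {x} {z} xz = begin
      k - c₃ + 1ℤ
        ≡⟨ cong (_+ 1ℤ) (trans (sub0 (k - c₃)) (cong (λ t → k - c₃ - t) (sym b₃≡0))) ⟩
      k - c₃ - + b 3 + 1ℤ
        ≡⟨ cong₂ _+_ (sym (count-a x z 2 xz)) (sym (trans (∑-δ z (S 3 x)) (δ-1 (sym xz)))) ⟩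
      ∑ (λ s → S 1 z s * S 3 x s) + ∑ (λ s → δ (toℕ z) (toℕ s) * S 3 x s)
        ≡⟨ ∑-+ _ _ ⟨
      ∑ (λ s → S 1 z s * S 3 x s + δ (toℕ z) (toℕ s) * S 3 x s)
        ≤⟨ ∑-mono (λ s → by-difference (gap (at-most-1 s) ⊗ S-nonneg 3 x s) (factor (S 1 z s) (S 0 z s) (δ (toℕ z) (toℕ s)) (S 3 x s) (S-0 z s))) ⟩
      ∣S∣ 3 x
        ∎
      where
      open ℤₚ.≤-Reasoning
      sub0 : ∀ u → u ≡ u - 0ℤ
      sub0 = solve-∀
      b₃≡0 : + b 3 ≡ 0ℤ
      b₃≡0 = trans (sym (count-b x z 3 xz)) (trans (∑-cong {g = λ _ → 0ℤ} (λ s →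
        trans (cong (S 1 z s *_) (δ-0 λ e → ℕₚ.<⇒≱ (ℕₚ.≤-reflexive e) (diam x s))) (ℤₚ.*-zeroʳ (S 1 z s)))) (∑-zero n))
      at-most-1 : ∀ s → S 1 z s + S 0 z s ≤ 1ℤ
      at-most-1 s with d z s
      ... | 0           = ℤₚ.≤-refl
      ... | 1           = ℤₚ.≤-refl
      ... | suc (suc _) = +-nonneg
      factor : ∀ u v w t → v ≡ w → t - (u * t + w * t) ≡ (1ℤ - (u + v)) * t
      factor u v .v t refl = ring u v t
        where
        ring : ∀ u v t → t - (u * t + v * t) ≡ (1ℤ - (u + v)) * t
        ring = solve-∀

  -- The sparse case: excluding edges inside spheres

  module Bipartition (Γ : DistanceRegular) where
    open Counting Γ
    open Configurations Γ

    term-≤-∑ : ∀ {f : V → ℤ} → (∀ i → 0ℤ ≤ f i) → ∀ i → f i ≤ ∑ f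
    term-≤-∑ {f} 0≤f i = subst (_≤ ∑ f) (∑-δ i f) (∑-mono λ j → by-difference
      (gap (δ-≤1 (toℕ i) (toℕ j)) ⊗ 0≤f j) (factor (f j) (δ (toℕ i) (toℕ j))))
      where
      factor : ∀ u t → u - t * u ≡ (1ℤ - t) * u
      factor = solve-∀

    common-neighbour : ∀ {x y} → 1ℤ ≤ common x y → ∃[ u ] d x u ≡ 1 × d y u ≡ 1
    common-neighbour {x} {y} h with u , p ← ∑-positive (λ s → S 1 x s * S 1 y s) h
      with δ-cases 1 (d x u) | δ-cases 1 (d y u)
    ... | inj₁ (q , _) | inj₁ (r , _) = u , sym q , sym r
    ... | inj₂ (_ , e) | _            = ⊥-elim (1≰0 (subst (1ℤ ≤_) (trans (cong (_* S 1 y u) e) (ℤₚ.*-zeroˡ (S 1 y u))) p))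
      where
      1≰0 : ¬ 1ℤ ≤ 0ℤ
      1≰0 (+≤+ ())
    ... | inj₁ _       | inj₂ (_ , e) = ⊥-elim (1≰0 (subst (1ℤ ≤_) (trans (cong (S 1 x u *_) e) (ℤₚ.*-zeroʳ (S 1 x u))) p))
      where
      1≰0 : ¬ 1ℤ ≤ 0ℤ
      1≰0 (+≤+ ())

    -- In a triangle x, y, u the neighbours of y and of u lie within distance 2 of x.
    triangle-bound : ∀ {x y u} → d x y ≡ 1 → d x u ≡ 1 → d y u ≡ 1 → k + k ≤ + 2 + + 3 * a₁ + ∣S∣ 2 x
    triangle-bound {x} {y} {u} xy xu yu = begin
      k + k
        ≡⟨ cong₂ _+_ (degree y) (degree u) ⟨
      ∣S∣ 1 y + ∣S∣ 1 u
        ≡⟨ ∑-+ (S 1 y) (S 1 u) ⟨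
      ∑ (λ s → S 1 y s + S 1 u s)
        ≤⟨ ∑-mono pointwise ⟩
      ∑ (combination terms)
        ≡⟨ ∑-combination terms ⟩
      combination-∑ terms
        ≡⟨ cong₂ (λ p q → + 2 * p + q) (trans (∑-cong (S-0 x)) one)
            (cong₂ (λ p q → 1ℤ * p + q) (common-1 xy) (cong₂ (λ p q → 1ℤ * p + (1ℤ * q + (1ℤ * ∣S∣ 2 x + 0ℤ))) (common-1 xu) (common-1 yu))) ⟩
      + 2 * 1ℤ + (1ℤ * a₁ + (1ℤ * a₁ + (1ℤ * a₁ + (1ℤ * ∣S∣ 2 x + 0ℤ))))
        ≡⟨ tidy a₁ (∣S∣ 2 x) ⟩
      + 2 + + 3 * a₁ + ∣S∣ 2 x
        ∎
      where
      open ℤₚ.≤-Reasoning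
      terms : List (ℤ × (V → ℤ))
      terms = (+ 2 , S 0 x) ∷ (1ℤ , λ s → S 1 x s * S 1 y s) ∷ (1ℤ , λ s → S 1 x s * S 1 u s)
            ∷ (1ℤ , λ s → S 1 y s * S 1 u s) ∷ (1ℤ , S 2 x) ∷ []
      one : ∑ (λ s → δ (toℕ x) (toℕ s)) ≡ 1ℤ
      one = trans (∑-cong (λ s → sym (ℤₚ.*-identityʳ _))) (∑-δ x (λ _ → 1ℤ))
      tidy : ∀ a t → + 2 * 1ℤ + (1ℤ * a + (1ℤ * a + (1ℤ * a + (1ℤ * t + 0ℤ)))) ≡ + 2 + + 3 * a + t
      tidy = solve-∀
      pointwise : ∀ s → S 1 y s + S 1 u s ≤ combination terms s
      pointwise s with d x s in eq
      ... | 0 = by-difference (gap (S-≤1 1 y s) ⊕ gap (S-≤1 1 u s) ⊕ S-nonneg 1 y s ⊗ S-nonneg 1 u s)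
                              (at-0 (S 1 y s) (S 1 u s))
        where
        at-0 : ∀ p q → + 2 * 1ℤ + (1ℤ * (0ℤ * p) + (1ℤ * (0ℤ * q) + (1ℤ * (p * q) + (1ℤ * 0ℤ + 0ℤ)))) - (p + q) ≡ 1ℤ - p + (1ℤ - q) + p * q
        at-0 = solve-∀
      ... | 1 = by-difference (S-nonneg 1 y s ⊗ S-nonneg 1 u s) (at-1 (S 1 y s) (S 1 u s))
        where
        at-1 : ∀ p q → + 2 * 0ℤ + (1ℤ * (1ℤ * p) + (1ℤ * (1ℤ * q) + (1ℤ * (p * q) + (1ℤ * 0ℤ + 0ℤ)))) - (p + q) ≡ p * q
        at-1 = solve-∀
      ... | 2 = by-difference (gap (S-≤1 1 y s) ⊗ gap (S-≤1 1 u s)) (at-2 (S 1 y s) (S 1 u s))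
        where
        at-2 : ∀ p q → + 2 * 0ℤ + (1ℤ * (0ℤ * p) + (1ℤ * (0ℤ * q) + (1ℤ * (p * q) + (1ℤ * 1ℤ + 0ℤ)))) - (p + q) ≡ (1ℤ - p) * (1ℤ - q)
        at-2 = solve-∀
      ... | suc (suc (suc m)) = by-difference (S-nonneg 1 y s ⊗ S-nonneg 1 u s)
              (trans (at-3 (S 1 y s) (S 1 u s)) (cong₂ (λ p q → S 1 y s * S 1 u s - p - q) (too-far xy) (too-far xu) ⟨ trans ⟩ tidy₃ (S 1 y s * S 1 u s)))
        where
        at-3 : ∀ p q → + 2 * 0ℤ + (1ℤ * (0ℤ * p) + (1ℤ * (0ℤ * q) + (1ℤ * (p * q) + (1ℤ * 0ℤ + 0ℤ)))) - (p + q) ≡ p * q - p - q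
        at-3 = solve-∀
        tidy₃ : ∀ t → t - 0ℤ - 0ℤ ≡ t
        tidy₃ = solve-∀
        too-far : ∀ {v} → d x v ≡ 1 → S 1 v s ≡ 0ℤ
        too-far xv = δ-0 λ e → ℕₚ.<⇒≱ (s≤s (s≤s (s≤s z≤n))) (subst (ℕ._≤ 2) eq (near-≤ xv (sym e)))

    module _ (a₁≡0 : a₁ ≡ 0ℤ) (k<2c₂ : k + 1ℤ ≤ c₂ + c₂) {x₀ z₀ : V} (x₀z₀ : d x₀ z₀ ≡ 3)
             (diam : ∀ x y → d x y ℕ.≤ 3) where

      private
        no-edge-1 : ∀ {x y z} → d x y ≡ 1 → d x z ≡ 1 → d y z ≡ 1 → ⊥
        no-edge-1 {x} {y} {z} xy xz yz = 1≰0 (subst₂ _≤_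
          (cong₂ _*_ (δ-1 (sym xz)) (δ-1 (sym yz))) (trans (common-1 xy) a₁≡0)
          (term-≤-∑ {λ s → S 1 x s * S 1 y s} (λ s → S-nonneg 1 x s ⊗ S-nonneg 1 y s) z))
          where
          1≰0 : ¬ 1ℤ ≤ 0ℤ
          1≰0 (+≤+ ())

        -- The neighbours of `x` contain `c₂` neighbours of `y` and `c₂` of `z`, and these overlap
        -- in at most `a₁ = 0` vertices, so `2c₂ ≤ k`.
        no-edge-2 : ∀ {x y z} → d x y ≡ 2 → d x z ≡ 2 → d y z ≡ 1 → ⊥
        no-edge-2 {x} {y} {z} xy xz yz = 1+≤⇒≰ k<2c₂ (subst₂ _≤_ (cong₂ _+_ (common-2 xy) (common-2 xz))
          (trans (cong (λ t → k + t) (trans (common-1 yz) a₁≡0)) (ℤₚ.+-identityʳ k)) (common-+-≤ x y z))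

        -- A neighbour of `x` at distance 2 from both `y` and `z` would have the edge `y z` inside
        -- its second sphere, so the two sets of `c₃` neighbours are disjoint.
        2c₃≤k : ∀ {x y z} → d x y ≡ 3 → d x z ≡ 3 → d y z ≡ 1 → c₃ + c₃ ≤ k
        2c₃≤k {x} {y} {z} xy xz yz = begin
          c₃ + c₃
            ≡⟨ cong₂ _+_ (sym (count-c y x 2 (trans (d-sym y x) xy))) (sym (count-c z x 2 (trans (d-sym z x) xz))) ⟩
          ∑ (λ s → S 1 x s * S 2 y s) + ∑ (λ s → S 1 x s * S 2 z s)
            ≡⟨ ∑-+ _ _ ⟨
          ∑ (λ s → S 1 x s * S 2 y s + S 1 x s * S 2 z s)
            ≡⟨ ∑-cong (λ s → ℤₚ.*-distribˡ-+ (S 1 x s) (S 2 y s) (S 2 z s)) ⟨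
          ∑ (λ s → S 1 x s * (S 2 y s + S 2 z s))
            ≤⟨ ∑-mono (λ s → by-difference (S-nonneg 1 x s ⊗ gap (exclusive s)) (factor (S 1 x s) (S 2 y s + S 2 z s))) ⟩
          ∣S∣ 1 x
            ≡⟨ degree x ⟩
          k
            ∎
          where
          open ℤₚ.≤-Reasoning
          factor : ∀ u t → u - u * t ≡ u * (1ℤ - t)
          factor = solve-∀
          exclusive : ∀ s → S 2 y s + S 2 z s ≤ 1ℤ
          exclusive s with δ-cases 2 (d y s) | δ-cases 2 (d z s)
          ... | inj₁ (p , _) | inj₁ (q , _) = ⊥-elim (no-edge-2 (trans (d-sym s y) (sym p)) (trans (d-sym s z) (sym q)) yz)
          ... | inj₂ (_ , e) | _            = subst (λ t → t + S 2 z s ≤ 1ℤ) (sym e)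
                                                (subst (_≤ 1ℤ) (sym (ℤₚ.+-identityˡ (S 2 z s))) (S-≤1 2 z s))
          ... | inj₁ _       | inj₂ (_ , e) = subst (λ t → S 2 y s + t ≤ 1ℤ) (sym e)
                                                (subst (_≤ 1ℤ) (sym (ℤₚ.+-identityʳ (S 2 y s))) (S-≤1 2 y s))

        c₂≤c₃ : c₂ ≤ c₃
        c₂≤c₃ with y , xy , yz ← geodesic 1 2 x₀z₀ = c₂≤c xy yz x₀z₀

        level-edge : ∀ {x y z} m → d x y ≡ m → d x z ≡ m → d y z ≡ 1 → ⊥
        level-edge 0 xy xz yz with refl ← d-zero xy with refl ← d-zero xz = case trans (sym (d-refl _)) yz of λ ()
        level-edge 1 xy xz yz = no-edge-1 xy xz yz
        level-edge 2 xy xz yz = no-edge-2 xy xz yz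
        level-edge 3 xy xz yz = 1+≤⇒≰ (ℤₚ.≤-trans k<2c₂ (ℤₚ.+-mono-≤ c₂≤c₃ c₂≤c₃)) (2c₃≤k xy xz yz)
        level-edge {x} {y} (suc (suc (suc (suc m)))) xy _ _ with s≤s (s≤s (s≤s ())) ← subst (ℕ._≤ 3) xy (diam x y)

        parity : ℕ → Bool
        parity zero    = false
        parity (suc m) = not (parity m)

        parity-step : ∀ m → parity m ≢ parity (suc m)
        parity-step m = not-¬ refl

      bipartition : Σ (V → Bool) λ f → ∀ x y → d x y ≡ 1 → f x ≢ f y
      bipartition = (λ x → parity (d x₀ x)) , proper
        where
        proper : ∀ x y → d x y ≡ 1 → parity (d x₀ x) ≢ parity (d x₀ y)
        proper x y xy with d x₀ x in p
        ... | zero with refl ← d-zero p = λ e → parity-step 0 (trans e (cong parity xy))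
        ... | suc m with step-cases p xy
        ...   | inj₁ q        = λ e → parity-step m (sym (trans e (cong parity q)))
        ...   | inj₂ (inj₁ q) = ⊥-elim (level-edge (suc m) p q xy)
        ...   | inj₂ (inj₂ q) = λ e → parity-step (suc m) (trans e (cong parity q))

  -- Choice of the constants

  -- The argument uses its constants only through these inequalities; as record fields their large
  -- literals are never unfolded.
  record Constants (ν : ℤ) : Set where
    field
      cap closeness : ℤ
      ℓ κ           : ℕ
      144ν²≤cap     : + 144 * (ν * ν) ≤ cap
      cap≤T         : + 144 * (ν * ν) ≤ closeness
      weight≤T      : + 6 * ν + + 18 * ν * cap ≤ closeness
      1≤ℓ           : 1ℤ ≤ + ℓ
      6480ν³≤ℓ      : + 6480 * (ν * ν * ν) ≤ + ℓ
      36νT²≤ℓ       : + 36 * ν * (closeness * closeness) ≤ + ℓ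
      ramsey≤κ      : 2 ℕ.^ (suc ℓ ℕ.+ suc ℓ) ℕ.≤ κ
      14≤κ          : + 14 ≤ + κ
      6ν≤κ          : + 6 * ν ≤ + κ
      1008ν²<κ      : + 1008 * (ν * ν) + + 7 ≤ + κ
      168νcap²<κ    : + 168 * ν * (cap * cap) + + 6 * ν + 1ℤ ≤ + κ
      28ν<κ         : + 28 * ν + 1ℤ ≤ + κ

  -- A sum of nonnegative bounds serves as their maximum; `r` makes room for the Ramsey number,
  -- which is a natural number.
  module Majorant {x₁ x₂ x₃ x₄ x₅ : ℤ} (0≤x₁ : 0ℤ ≤ x₁) (0≤x₂ : 0ℤ ≤ x₂) (0≤x₃ : 0ℤ ≤ x₃) (0≤x₄ : 0ℤ ≤ x₄) (0≤x₅ : 0ℤ ≤ x₅)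
    (r : ℕ) where

    majorant : ℕ
    majorant = r ℕ.+ ∣ x₁ + x₂ + x₃ + x₄ + x₅ ∣

    total≤ : x₁ + x₂ + x₃ + x₄ + x₅ ≤ + majorant
    total≤ = subst (_≤ + majorant) (ℤₚ.0≤i⇒+∣i∣≡i (0≤x₁ ⊕ 0≤x₂ ⊕ 0≤x₃ ⊕ 0≤x₄ ⊕ 0≤x₅)) (+≤+ (ℕₚ.m≤n+m _ r))

    r≤ : r ℕ.≤ majorant
    r≤ = ℕₚ.m≤m+n r _

    x₁≤ : x₁ ≤ + majorant
    x₁≤ = ℤₚ.≤-trans (≤-+ʳ 0≤x₂) (ℤₚ.≤-trans (≤-+ʳ 0≤x₃) (ℤₚ.≤-trans (≤-+ʳ 0≤x₄) (ℤₚ.≤-trans (≤-+ʳ 0≤x₅) total≤)))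
    x₂≤ : x₂ ≤ + majorant
    x₂≤ = ℤₚ.≤-trans (≤-+ˡ 0≤x₁) (ℤₚ.≤-trans (≤-+ʳ 0≤x₃) (ℤₚ.≤-trans (≤-+ʳ 0≤x₄) (ℤₚ.≤-trans (≤-+ʳ 0≤x₅) total≤)))
    x₃≤ : x₃ ≤ + majorant
    x₃≤ = ℤₚ.≤-trans (≤-+ˡ (0≤x₁ ⊕ 0≤x₂)) (ℤₚ.≤-trans (≤-+ʳ 0≤x₄) (ℤₚ.≤-trans (≤-+ʳ 0≤x₅) total≤))
    x₄≤ : x₄ ≤ + majorant
    x₄≤ = ℤₚ.≤-trans (≤-+ˡ (0≤x₁ ⊕ 0≤x₂ ⊕ 0≤x₃)) (ℤₚ.≤-trans (≤-+ʳ 0≤x₅) total≤)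
    x₅≤ : x₅ ≤ + majorant
    x₅≤ = ℤₚ.≤-trans (≤-+ˡ (0≤x₁ ⊕ 0≤x₂ ⊕ 0≤x₃ ⊕ 0≤x₄)) total≤

  -- Each constant depends only on earlier ones: `cap` bounds `b₂`, `T` fixes how close `a₁` must be
  -- to `c₂`, `ℓ` is the family size that achieves this, and `κ` the valency at which Ramsey's
  -- theorem supplies the family.
  constants : ∀ {ν} → 1ℤ ≤ ν → Constants ν
  constants {ν} 1≤ν = record
    { cap = cap ; closeness = T ; ℓ = L.majorant ; κ = K.majorant
    ; 144ν²≤cap = ℤₚ.≤-refl ; cap≤T = ≤-+ʳ 0≤w ; weight≤T = ≤-+ˡ 0≤cap
    ; 1≤ℓ = L.x₁≤ ; 6480ν³≤ℓ = L.x₂≤ ; 36νT²≤ℓ = L.x₃≤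
    ; ramsey≤κ = K.r≤ ; 14≤κ = K.x₁≤ ; 6ν≤κ = K.x₂≤ ; 1008ν²<κ = K.x₃≤ ; 168νcap²<κ = K.x₄≤ ; 28ν<κ = K.x₅≤
    }
    where
    0≤ν : 0ℤ ≤ ν
    0≤ν = ℤₚ.≤-trans +-nonneg 1≤ν
    cap w T : ℤ
    cap = + 144 * (ν * ν)
    w = + 6 * ν + + 18 * ν * cap
    T = cap + w
    0≤cap : 0ℤ ≤ cap
    0≤cap = +-nonneg {144} ⊗ square-nonneg ν
    0≤w : 0ℤ ≤ w
    0≤w = +-nonneg {6} ⊗ 0≤ν ⊕ +-nonneg {18} ⊗ 0≤ν ⊗ 0≤cap
    module L = Majorant {1ℤ} {+ 6480 * (ν * ν * ν)} {+ 36 * ν * (T * T)} {0ℤ} {0ℤ}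
      +-nonneg (+-nonneg {6480} ⊗ (square-nonneg ν ⊗ 0≤ν)) (+-nonneg {36} ⊗ 0≤ν ⊗ square-nonneg T) +-nonneg +-nonneg 0
    module K = Majorant {+ 14} {+ 6 * ν} {+ 1008 * (ν * ν) + + 7} {+ 168 * ν * (cap * cap) + + 6 * ν + 1ℤ} {+ 28 * ν + 1ℤ}
      +-nonneg (+-nonneg {6} ⊗ 0≤ν) (+-nonneg {1008} ⊗ square-nonneg ν ⊕ +-nonneg {7})
      (+-nonneg {168} ⊗ 0≤ν ⊗ square-nonneg cap ⊕ +-nonneg {6} ⊗ 0≤ν ⊕ +-nonneg {1})
      (+-nonneg {28} ⊗ 0≤ν ⊕ +-nonneg {1}) (2 ℕ.^ (suc L.majorant ℕ.+ suc L.majorant))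

  -- The two cases assembled

  module Classification (Γ : DistanceRegular) where
    open Counting Γ
    open Configurations Γ
    open Extremal Γ
    open Bipartition Γ

    Proper : (V → Bool) → Set
    Proper f = ∀ x y → d x y ≡ 1 → f x ≢ f y

    -- A pair at distance 4 with the midpoint of a geodesic gives `c₂ ≤ b₂` through `c₂≤b`.
    diameter-≤3 : ¬ c₂ ≤ b₂ → ∀ x y → d x y ℕ.≤ 3
    diameter-≤3 c₂≰b₂ x y with d x y ℕₚ.≤? 3
    ... | yes p = p
    ... | no ¬p with w , xw , _ ← geodesic 4 (d x y ℕ.∸ 4) (sym (ℕₚ.m+[n∸m]≡n (ℕₚ.≰⇒> ¬p)))
        with u , xu , uw ← geodesic 2 2 xw = ⊥-elim (c₂≰b₂ (c₂≤b xu uw xw))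

    family : ∀ {R : V → V → Set} → (∀ {x y} → R x y → R y x) → ∀ {l} ys → length ys ≡ l → AllPairs R ys →
             Σ (Fin l → V) λ X → ∀ i j → i ≢ j → R (X i) (X j)
    family R-sym ys refl ps = lookup ys , AllPairs-lookup R-sym ps

    neighbours-apart : ∀ {x xs} → Unique xs → All (λ y → d x y ≡ 1) xs →
                       AllPairs (λ y z → d y z ≡ 1 ⊎ d y z ≡ 2) xs
    neighbours-apart []       []       = []
    neighbours-apart {x} (u ∷ us) (p ∷ ps) = All.zipWith (λ (y≢z , q) → apart p q y≢z) (u , ps) ∷ neighbours-apart us ps
      where
      apart : ∀ {y z} → d x y ≡ 1 → d x z ≡ 1 → y ≢ z → d y z ≡ 1 ⊎ d y z ≡ 2
      apart {y} {z} p q y≢z with d y z in eq | near-≤ {y} {x} {z} (trans (d-sym y x) p) q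
      ... | 0                 | _                = ⊥-elim (y≢z (d-zero eq))
      ... | 1                 | _                = inj₁ refl
      ... | 2                 | _                = inj₂ refl
      ... | suc (suc (suc _)) | s≤s (s≤s ())

    module _ {ν k₂ : ℤ} (1≤ν : 1ℤ ≤ ν) (C : Constants ν) {x₀ z₀ : V} (x₀z₀ : d x₀ z₀ ≡ 3)
      (∣S∣₂ : ∀ x → ∣S∣ 2 x ≡ k₂) (k₂-small : ν * k₂ + k ≤ + 2 * ν * k)
      {xs : List V} (xs-unique : Unique xs) (xs-near : All (λ y → d x₀ y ≡ 1) xs) (∣xs∣ : length xs ≡ b 0)
      (κ≤b₀ : Constants.κ C ℕ.≤ b 0) where

      open Constants C using (cap; ℓ) renaming (closeness to T)

      private
        ≤k : ∀ {x} → x ≤ + Constants.κ C → x ≤ k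
        ≤k h = ℤₚ.≤-trans h (+≤+ κ≤b₀)

        14≤k : + 14 ≤ k
        14≤k = ≤k (Constants.14≤κ C)

        1≤k : 1ℤ ≤ k
        1≤k = ℤₚ.≤-trans (+≤+ (s≤s z≤n)) 14≤k

        c₂≤b₁ : c₂ ≤ b₁
        c₂≤b₁ with y , xy , yz ← geodesic 1 2 x₀z₀ = c₂≤b xy yz x₀z₀

        c₂≤c₃ : c₂ ≤ c₃
        c₂≤c₃ with y , xy , yz ← geodesic 1 2 x₀z₀ = c₂≤c xy yz x₀z₀

        0≤a₁ : 0ℤ ≤ a₁
        0≤a₁ with y , xy , _ ← geodesic 1 2 x₀z₀ = subst (λ t → 0ℤ ≤ k - t - b₁) (c₁≡1 xy) (a-nonneg xy)

        0≤a₂ : 0ℤ ≤ a₂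
        0≤a₂ with y , xy , _ ← geodesic 2 1 x₀z₀ = a-nonneg xy

        2a₁≤ : a₁ + a₁ ≤ k + c₂
        2a₁≤ with y , xy , _ ← geodesic 2 1 x₀z₀ = 2a₁≤k+c₂ xy

        c₃≤k : c₃ ≤ k
        c₃≤k = by-difference (a-nonneg x₀z₀ ⊕ +-nonneg {b 3}) (drop-b k c₃ (+ b 3))
          where
          drop-b : ∀ u v w → u - v ≡ u - v - w + w
          drop-b = solve-∀

        k₂c₂≡kb₁ : k₂ * c₂ ≡ k * b₁
        k₂c₂≡kb₁ = trans (cong (_* c₂) (sym (∣S∣₂ x₀))) (trans (handshake 1 x₀) (cong (_* b₁) (degree x₀)))

        k₃c₃≡k₂b₂ : ∀ x → ∣S∣ 3 x * c₃ ≡ k₂ * b₂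
        k₃c₃≡k₂b₂ x = trans (handshake 2 x) (cong (_* b₂) (∣S∣₂ x))

      open Estimates {ν} {k} {b₁} {c₂} {k₂} 1≤ν 1≤k +-nonneg k₂-small k₂c₂≡kb₁ c₂≤b₁ 0≤a₁ 2a₁≤

      Taylor : Set
      Taylor = c₂ ≡ b₁ × b₂ ≡ 1ℤ × c₃ ≡ k

      sparse-case : + 3 * ν * (a₁ + 1ℤ) + 1ℤ ≤ k → (∀ x y → d x y ℕ.≤ 3) × Σ (V → Bool) Proper
      sparse-case a-small = diam , bipartition a₁≡0 k<2c₂ x₀z₀ diam
        where
        open Sparse a-small
        diam : ∀ x y → d x y ℕ.≤ 3
        -- `c₂ ≤ b₂` would give `2c₂ ≤ c₂ + b₂ ≤ k`, the last step being `0≤a₂`.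
        diam = diameter-≤3 λ c₂≤b₂ → 1+≤⇒≰ {k} {c₂ + c₂} k<2c₂ (by-difference {c₂ + c₂} {k} (0≤a₂ ⊕ gap c₂≤b₂) (split k c₂ b₂))
          where
          split : ∀ k c b → k - (c + c) ≡ k - c - b + (b - c)
          split = solve-∀
        a₁≡0 : a₁ ≡ 0ℤ
        a₁≡0 = ℤₚ.≤-antisym (≤-by-contradiction λ 1≤a₁ → triangle-free (subst (_≤ a₁) (ℤₚ.+-identityˡ 1ℤ) 1≤a₁)) 0≤a₁
          where
          triangle-free : ¬ 1ℤ ≤ a₁
          triangle-free 1≤a₁ =
            let y , xy , _ = geodesic 1 2 x₀z₀
                u , xu , yu = common-neighbour (subst (1ℤ ≤_) (sym (common-1 xy)) 1≤a₁)
            in no-triangles (subst (λ t → k + k ≤ + 2 + + 3 * a₁ + t) (∣S∣₂ x₀) (triangle-bound xy xu yu))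

      module DenseCase (a-large : k ≤ + 3 * ν * (a₁ + 1ℤ)) where
        open Dense a-large (≤k (Constants.6ν≤κ C)) 14≤k

        private
          gap² : ℤ
          gap² = (a₁ - c₂) * (a₁ - c₂)

          b₂≤k : b₂ ≤ k
          b₂≤k = by-difference (0≤a₂ ⊕ +-nonneg {c 2}) (drop-c k c₂ b₂)
            where
            drop-c : ∀ k c b → k - b ≡ k - c - b + c
            drop-c = solve-∀

          ∣S∣₃≤14b₂ : ∀ x → ∣S∣ 3 x ≤ + 14 * b₂
          ∣S∣₃≤14b₂ x = m≤14b₂ {b₂} {c₃} {∣S∣ 3 x} +-nonneg (∣S∣-nonneg 3 x) c₂≤c₃ (k₃c₃≡k₂b₂ x)

          ∣S∣₃≤14k : ∀ x → ∣S∣ 3 x ≤ + 14 * k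
          ∣S∣₃≤14k x = ℤₚ.≤-trans (∣S∣₃≤14b₂ x) (ℤₚ.*-monoˡ-≤-nonNeg (+ 14) b₂≤k)

          ∣S∣₂≤ : ∀ x → ∣S∣ 2 x ≤ k₂
          ∣S∣₂≤ x = ℤₚ.≤-reflexive (∣S∣₂ x)

          flip : ∀ {i} {x y : V} → d x y ≡ i → d y x ≡ i
          flip {i} {x} {y} p = trans (d-sym y x) p

          common-far : ∀ {x y} → d x y ≡ 3 → common x y ≡ 0ℤ
          common-far p = common-≥3 (ℕₚ.≤-reflexive (sym p))

          clique-spread : (X : Fin (suc ℓ) → V) → (∀ i j → i ≢ j → d (X i) (X j) ≡ 1) → + ℓ * gap² ≤ + 36 * ν * (k * k)
          clique-spread X apart = spread-clique {+ ℓ} {gap²} +-nonneg (square-nonneg (a₁ - c₂))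
            (Homogeneous.spread-bound {ℓ} {1} {2} {a₁} {c₂} {b₁} {k₂} X 1≤k 0≤a₁ (λ ()) apart common-1 common-2
              (λ {x} {y} p → count-b y x 1 (flip p)) ∣S∣₂≤)

          -- Two runs on one family: distance 3, with value 0 and count `b₂`, makes `a₂` linear in
          -- `k`; distance 2, with value `c₂` and count `a₂`, then compares `a₁` with `c₂`.
          coclique-spread : (X : Fin (suc ℓ) → V) → (∀ i j → i ≢ j → d (X i) (X j) ≡ 2) → + ℓ * gap² ≤ + 36 * ν * (k * k)
          coclique-spread X apart = spread-coclique {+ ℓ} {gap²} +-nonneg (square-nonneg (a₁ - c₂)) {b₂} +-nonneg (Constants.6480ν³≤ℓ C)
            (k≤12na₂ {+ ℓ} {gap²} +-nonneg (square-nonneg (a₁ - c₂)) {b₂} +-nonneg (Constants.6480ν³≤ℓ C) (Constants.1≤ℓ C)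
              (spread-b₂ {+ ℓ} {gap²} +-nonneg (square-nonneg (a₁ - c₂)) {b₂} +-nonneg (Constants.6480ν³≤ℓ C)
                (Homogeneous.spread-bound {ℓ} {2} {3} {c₂} {0ℤ} {b₂} {+ 14 * k} X 1≤k +-nonneg (λ ()) apart common-2 common-far
                  (λ {x} {y} p → count-b y x 2 (flip p)) ∣S∣₃≤14k)))
            (Homogeneous.spread-bound {ℓ} {2} {2} {c₂} {c₂} {a₂} {k₂} X 1≤k +-nonneg (λ ()) apart common-2 common-2
              (λ {x} {y} p → count-a y x 1 (flip p)) ∣S∣₂≤)

          spread : + ℓ * gap² ≤ + 36 * ν * (k * k)
          spread = [ (λ (ys , _ , ps , len) → let X , apart = family flip ys len ps in clique-spread X apart)
                   , (λ (ys , _ , ps , len) → let X , apart = family flip ys len ps in coclique-spread X apart)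
                   ]′ (ramsey (suc ℓ) (suc ℓ) (neighbours-apart xs-unique xs-near)
                        (subst (2 ℕ.^ (suc ℓ ℕ.+ suc ℓ) ℕ.≤_) (sym ∣xs∣) (ℕₚ.≤-trans (Constants.ramsey≤κ C) κ≤b₀)))

          -- `e` is |`a₁` - `c₂`|; the one-sided forms let `c₂ + e` bound both `a₁` and `c₂`.
          Close : ℤ → Set
          Close e = 0ℤ ≤ e × T * e ≤ k × a₁ ≤ c₂ + e × c₂ - e ≤ a₁

          ∃e : ∃[ e ] Close e
          ∃e = [ below , above ]′ (≤-or-> a₁ c₂)
            where
            below : a₁ ≤ c₂ → ∃[ e ] Close e
            below p = c₂ - a₁ , gap p ,
              spread⇒close {+ ℓ} {T} {c₂ - a₁} (Constants.36νT²≤ℓ C) (subst (λ t → + ℓ * t ≤ + 36 * ν * (k * k)) (e₀ a₁ c₂) spread) ,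
              by-difference (+-nonneg {2} ⊗ gap p) (e₁ a₁ c₂) , by-difference (ℤₚ.≤-refl {0ℤ}) (e₂ a₁ c₂)
              where
              e₀ : ∀ a c → (a - c) * (a - c) ≡ (c - a) * (c - a)
              e₀ = solve-∀
              e₁ : ∀ a c → c + (c - a) - a ≡ + 2 * (c - a)
              e₁ = solve-∀
              e₂ : ∀ a c → a - (c - (c - a)) ≡ 0ℤ
              e₂ = solve-∀
            above : c₂ + 1ℤ ≤ a₁ → ∃[ e ] Close e
            above p = a₁ - c₂ , 0≤g , spread⇒close {+ ℓ} {T} {a₁ - c₂} (Constants.36νT²≤ℓ C) spread ,
              by-difference (ℤₚ.≤-refl {0ℤ}) (e₁ a₁ c₂) , by-difference (+-nonneg {2} ⊗ 0≤g) (e₂ a₁ c₂)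
              where
              0≤g : 0ℤ ≤ a₁ - c₂
              0≤g = gap (ℤₚ.≤-trans (≤-+ʳ (+-nonneg {1})) p)
              e₁ : ∀ a c → c + (a - c) - a ≡ 0ℤ
              e₁ = solve-∀
              e₂ : ∀ a c → a - (c - (a - c)) ≡ + 2 * (a - c)
              e₂ = solve-∀

        close⇒taylor : ∀ {e} → 0ℤ ≤ e → T * e ≤ k → a₁ ≤ c₂ + e → c₂ - e ≤ a₁ → (∀ x y → d x y ℕ.≤ 3) × Taylor
        close⇒taylor {e} 0≤e Te≤k a₁≤c₂+e c₂-e≤a₁ = diam , c₂≡b₁ , b₂≡1 , c₃≡k
          where
          m : ℤ
          m = ∣S∣ 3 x₀
          weaken : ∀ {w} → w ≤ T → w * e ≤ k
          weaken w≤T = ℤₚ.≤-trans (ℤₚ.*-monoʳ-≤-nonNeg e {{nonNegative 0≤e}} w≤T) Te≤k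
          e-small₁ : + 144 * (ν * ν) * e ≤ k
          e-small₁ = weaken (Constants.cap≤T C)
          e-small₂ : (+ 6 * ν + + 18 * ν * cap) * e ≤ k
          e-small₂ = weaken (Constants.weight≤T C)
          0≤M : 0ℤ ≤ c₂ + e
          0≤M = +-nonneg ⊕ 0≤e
          b₂≤144ν² : b₂ ≤ + 144 * (ν * ν)
          b₂≤144ν² = let y , xy , _ = geodesic 2 1 x₀z₀ in b₂≤144n² {e} {b₂} 0≤e +-nonneg e-small₁ (≤k (Constants.1008ν²<κ C))
            (fan-inequality xy 1≤k 0≤M a₁≤c₂+e (≤-+ʳ 0≤e))
          b₂≤cap : b₂ ≤ cap
          b₂≤cap = ℤₚ.≤-trans b₂≤144ν² (Constants.144ν²≤cap C)
          diam : ∀ x y → d x y ℕ.≤ 3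
          diam = diameter-≤3 λ c₂≤b₂ → 1+≤⇒≰ (144n²<c₂ {e} {b₂} 0≤e +-nonneg e-small₁ (≤k (Constants.1008ν²<κ C))) (ℤₚ.≤-trans c₂≤b₂ b₂≤144ν²)
          k-c₃<m : k - c₃ + 1ℤ ≤ m
          k-c₃<m = last-layer diam x₀z₀
          1≤m : 1ℤ ≤ m
          1≤m = ℤₚ.≤-trans (≤-+ˡ (gap c₃≤k)) k-c₃<m
          0≤m : 0ℤ ≤ m
          0≤m = ∣S∣-nonneg 3 x₀
          b₂≤1′ : b₂ ≤ 1ℤ
          b₂≤1′ = b₂≤1 {e} {b₂} {c₃} {m} {cap} 0≤e 0≤m +-nonneg a₁≤c₂+e c₂-e≤a₁ (k₃c₃≡k₂b₂ x₀) (∣S∣₃≤14b₂ x₀) k-c₃<m c₃≤k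
            b₂≤cap e-small₂ (≤k (Constants.168νcap²<κ C)) (antipode-count x₀z₀ 0≤M a₁≤c₂+e (≤-+ʳ 0≤e))
          1≤b₂ : 1ℤ ≤ b₂
          -- The third sphere is nonempty and has at most `14 * b₂` vertices.
          1≤b₂ = ≤-by-contradiction λ b₂<1 → 1+≤⇒≰ {0ℤ} {+ 14 * b₂}
            (ℤₚ.≤-trans (ℤₚ.≤-reflexive (ℤₚ.+-identityˡ 1ℤ)) (ℤₚ.≤-trans 1≤m (∣S∣₃≤14b₂ x₀)))
            (by-difference (+-nonneg {14} ⊗ gap b₂<1) (scale b₂))
            where
            scale : ∀ b → 0ℤ - + 14 * b ≡ + 14 * (1ℤ - (b + 1ℤ))
            scale = solve-∀
          b₂≡1 : b₂ ≡ 1ℤ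
          b₂≡1 = ℤₚ.≤-antisym b₂≤1′ 1≤b₂
          mc₃≡k₂ : m * c₃ ≡ k₂
          mc₃≡k₂ = trans (k₃c₃≡k₂b₂ x₀) (trans (cong (k₂ *_) b₂≡1) (ℤₚ.*-identityʳ k₂))
          m≡1 : m ≡ 1ℤ
          m≡1 = ℤₚ.≤-antisym (m≤1 {e} {b₂} {c₃} {m} {cap} 0≤e 0≤m +-nonneg a₁≤c₂+e c₂-e≤a₁ (k₃c₃≡k₂b₂ x₀) (∣S∣₃≤14b₂ x₀) k-c₃<m c₃≤k
            mc₃≡k₂ (subst (λ t → m ≤ + 14 * t) b₂≡1 (∣S∣₃≤14b₂ x₀)) (≤k (Constants.28ν<κ C))) 1≤m
          c₃≡k : c₃ ≡ k
          c₃≡k = ℤₚ.≤-antisym c₃≤k (by-difference (gap (subst (k - c₃ + 1ℤ ≤_) m≡1 k-c₃<m)) (shift k c₃))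
            where
            shift : ∀ k c → c - k ≡ 1ℤ - (k - c + 1ℤ)
            shift = solve-∀
          k₂≡k : k₂ ≡ k
          k₂≡k = trans (sym mc₃≡k₂) (trans (cong (_* c₃) m≡1) (trans (ℤₚ.*-identityˡ c₃) c₃≡k))
          kc₂≡kb₁ : k * c₂ ≡ k * b₁
          kc₂≡kb₁ = trans (cong (_* c₂) (sym k₂≡k)) k₂c₂≡kb₁
          c₂≡b₁ : c₂ ≡ b₁
          c₂≡b₁ = ℤₚ.≤-antisym c₂≤b₁
            (cancel-positive {k} {b₁} {c₂} 1≤k (ℤₚ.≤-reflexive (sym kc₂≡kb₁)))

        taylor : (∀ x y → d x y ℕ.≤ 3) × Taylor
        taylor = let _ , 0≤e , Te≤k , a₁≤ , ≤a₁ = ∃e in close⇒taylor 0≤e Te≤k a₁≤ ≤a₁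

      classification : (∀ x y → d x y ℕ.≤ 3) × (Σ (V → Bool) Proper ⊎ Taylor)
      classification = [ (λ a-large → let diam , t = DenseCase.taylor a-large in diam , inj₂ t)
                       , (λ a-small → let diam , f = sparse-case a-small in diam , inj₁ f)
                       ]′ (≤-or-> k (+ 3 * ν * (a₁ + 1ℤ)))

  -- From walks and lists to indicator sums

  -- In a duplicate-free list every multiplicity is 0 or 1, so `f` is the multiplicity function of
  -- the listing, whose sum is the length.
  ∑-HasSize : ∀ {n m} {P : Fin n → Set} (f : Fin n → ℤ) →
    (∀ z → (P z × f z ≡ 1ℤ) ⊎ (¬ P z × f z ≡ 0ℤ)) → HasSize P m → ∑ f ≡ + m
  ∑-HasSize {n} {m} {P} f f-bit (l , l-unique , l⇔P , refl) = trans (∑-cong f≡multiplicity) (∑-multiplicity l)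
    where
    multiplicity : List (Fin n) → Fin n → ℤ
    multiplicity []       z = 0ℤ
    multiplicity (v ∷ vs) z = δ (toℕ v) (toℕ z) * 1ℤ + multiplicity vs z

    ∑-multiplicity : ∀ vs → ∑ (multiplicity vs) ≡ + length vs
    ∑-multiplicity []       = ∑-zero n
    ∑-multiplicity (v ∷ vs) = trans (∑-+ _ (multiplicity vs)) (cong₂ _+_ (∑-δ v (λ _ → 1ℤ)) (∑-multiplicity vs))

    absent : ∀ vs z → z ∉ vs → multiplicity vs z ≡ 0ℤ
    absent []       z z∉ = refl
    absent (v ∷ vs) z z∉ = cong₂ (λ s t → s * 1ℤ + t) (δ-0 λ e → z∉ (here (sym (toℕ-injective e)))) (absent vs z (z∉ ∘ there))

    present : ∀ {vs} → Unique vs → ∀ {z} → z ∈ vs → multiplicity vs z ≡ 1ℤ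
    present {v ∷ vs} (v∉ ∷ _) (here refl) =
      cong₂ (λ s t → s * 1ℤ + t) (δ-1 {toℕ v} refl) (absent vs v λ v∈ → All.lookup v∉ v∈ refl)
    present {v ∷ vs} (v∉ ∷ u) (there z∈) =
      cong₂ (λ s t → s * 1ℤ + t) (δ-0 λ e → All.lookup v∉ z∈ (toℕ-injective e)) (present u z∈)

    f≡multiplicity : ∀ z → f z ≡ multiplicity l z
    f≡multiplicity z with f-bit z
    ... | inj₁ (Pz , e)  = trans e (sym (present l-unique (Equivalence.from (l⇔P z) Pz)))
    ... | inj₂ (¬Pz , e) = trans e (sym (absent l z (¬Pz ∘ Equivalence.to (l⇔P z))))

  module FromGraph (G : Graph) {D : ℕ} {b c : ℕ → ℕ} (regular : IsDistanceRegular G D b c) where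
    open Graph G using (n; Adj) renaming (sym to Adj-sym)

    private
      connected : Connected G
      connected = proj₁ (proj₁ regular)

    -- Connectedness supplies the distance as data. Adjacency, an arbitrary relation, thereby
    -- becomes decidable as distance 1.
    dist : Fin n → Fin n → ℕ
    dist x y = proj₁ (connected x y)

    dist-Dist : ∀ x y → Dist G x y (dist x y)
    dist-Dist x y = proj₂ (connected x y)

    dist-≤ : ∀ {x y m} → Walk G x y m → dist x y ℕ.≤ m
    dist-≤ {x} {y} {m} w = ℕₚ.≮⇒≥ λ m<d → proj₂ (dist-Dist x y) m m<d w

    Dist⇒dist≡ : ∀ {x y i} → Dist G x y i → dist x y ≡ i
    Dist⇒dist≡ {x} {y} {i} (w , minimal) =
      ℕₚ.≤-antisym (dist-≤ w) (ℕₚ.≮⇒≥ λ d<i → minimal (dist x y) d<i (proj₁ (dist-Dist x y)))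

    dist≡⇒Dist : ∀ {x y i} → dist x y ≡ i → Dist G x y i
    dist≡⇒Dist {x} {y} refl = dist-Dist x y

    private
      append : ∀ {x y z i j} → Walk G x y i → Walk G y z j → Walk G x z (i ℕ.+ j)
      append nil        w′ = w′
      append (cons a w) w′ = cons a (append w w′)

      reverse : ∀ {x y i} → Walk G x y i → Walk G y x i
      reverse nil                    = nil
      reverse (cons {m = m} a w) = subst (Walk G _ _) (ℕₚ.+-comm m 1) (append (reverse w) (cons (Adj-sym a) nil))

      break : ∀ i {j x z} → Walk G x z (i ℕ.+ j) → ∃[ y ] Walk G x y i × Walk G y z j
      break zero    w          = _ , nil , w
      break (suc i) (cons a w) with y , u , v ← break i w = y , cons a u , v

    dist-refl : ∀ x → dist x x ≡ 0
    dist-refl x = ℕₚ.n≤0⇒n≡0 (dist-≤ nil)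

    dist-zero : ∀ {x y} → dist x y ≡ 0 → x ≡ y
    dist-zero p with nil ← proj₁ (dist≡⇒Dist p) = refl

    dist-sym : ∀ x y → dist x y ≡ dist y x
    dist-sym x y = ℕₚ.≤-antisym (dist-≤ (reverse (proj₁ (dist-Dist y x)))) (dist-≤ (reverse (proj₁ (dist-Dist x y))))

    dist-triangle : ∀ x y z → dist x z ℕ.≤ dist x y ℕ.+ dist y z
    dist-triangle x y z = dist-≤ (append (proj₁ (dist-Dist x y)) (proj₁ (dist-Dist y z)))

    -- Cutting a shortest walk bounds both distances from above; the triangle inequality leaves no
    -- slack in either.
    dist-geodesic : ∀ i j {x z} → dist x z ≡ i ℕ.+ j → ∃[ y ] dist x y ≡ i × dist y z ≡ j
    dist-geodesic i j {x} {z} p with y , u , v ← break i (proj₁ (dist≡⇒Dist p)) =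
      y , ℕₚ.≤-antisym (dist-≤ u) (ℕₚ.+-cancelʳ-≤ j i (dist x y) (ℕₚ.≤-trans i+j≤ (ℕₚ.+-monoʳ-≤ (dist x y) (dist-≤ v))))
        , ℕₚ.≤-antisym (dist-≤ v) (ℕₚ.+-cancelˡ-≤ i j (dist y z) (ℕₚ.≤-trans i+j≤ (ℕₚ.+-monoˡ-≤ (dist y z) (dist-≤ u))))
      where
      i+j≤ : i ℕ.+ j ℕ.≤ dist x y ℕ.+ dist y z
      i+j≤ = subst (ℕ._≤ dist x y ℕ.+ dist y z) p (dist-triangle x y z)

    Adj⇒dist≡1 : ∀ {x y} → Adj x y → dist x y ≡ 1
    Adj⇒dist≡1 {x} {y} a = ℕₚ.≤-antisym (dist-≤ (cons a nil)) (ℕₚ.n≢0⇒n>0 λ p →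
      Graph.irrefl G (subst (Adj x) (sym (dist-zero p)) a))

    dist≡1⇒Adj : ∀ {x y} → dist x y ≡ 1 → Adj x y
    dist≡1⇒Adj p with cons a nil ← proj₁ (dist≡⇒Dist p) = a

    layer-sum : ∀ {x y i m} → HasSize (λ z → Adj y z × Dist G x z i) m →
                ∑ (λ z → δ 1 (dist y z) * δ i (dist x z)) ≡ + m
    layer-sum {x} {y} {i} = ∑-HasSize _ bit
      where
      bit : ∀ z → ((Adj y z × Dist G x z i) × δ 1 (dist y z) * δ i (dist x z) ≡ 1ℤ)
                ⊎ (¬ (Adj y z × Dist G x z i) × δ 1 (dist y z) * δ i (dist x z) ≡ 0ℤ)
      bit z with δ-cases 1 (dist y z) | δ-cases i (dist x z)
      ... | inj₁ (p , e) | inj₁ (q , f) = inj₁ ((dist≡1⇒Adj (sym p) , dist≡⇒Dist (sym q)) , cong₂ _*_ e f)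
      ... | inj₂ (p , e) | _            = inj₂ ((λ (a , _) → p (sym (Adj⇒dist≡1 a))) ,
                                            trans (cong (_* δ i (dist x z)) e) (ℤₚ.*-zeroˡ (δ i (dist x z))))
      ... | inj₁ _       | inj₂ (q , f) = inj₂ ((λ (_ , t) → q (sym (Dist⇒dist≡ t))) ,
                                            trans (cong (δ 1 (dist y z) *_) f) (ℤₚ.*-zeroʳ (δ 1 (dist y z))))

    sphere-sum : ∀ {x i m} → HasSize (λ z → Dist G x z i) m → ∑ (λ z → δ i (dist x z)) ≡ + m
    sphere-sum {x} {i} = ∑-HasSize _ bit
      where
      bit : ∀ z → (Dist G x z i × δ i (dist x z) ≡ 1ℤ) ⊎ (¬ Dist G x z i × δ i (dist x z) ≡ 0ℤ)
      bit z with δ-cases i (dist x z)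
      ... | inj₁ (p , e) = inj₁ (dist≡⇒Dist (sym p) , e)
      ... | inj₂ (p , e) = inj₂ ((λ t → p (sym (Dist⇒dist≡ t))) , e)

    distanceRegular : DistanceRegular
    distanceRegular = record
      { n = n ; d = dist ; d-refl = dist-refl ; d-zero = dist-zero ; d-sym = dist-sym
      ; triangle = dist-triangle ; geodesic = dist-geodesic ; b = b ; c = c
      ; count-c = λ x y i p → layer-sum (proj₁ (proj₂ regular x y (suc i) (dist≡⇒Dist p)))
      ; count-b = λ x y i p → layer-sum (proj₂ (proj₂ regular x y i (dist≡⇒Dist p)))
      }

    open Counting distanceRegular using (∣S∣; k; b₁; b₂; c₂; c₃; c₁≡1)

    module _ {ν : ℤ} {k₂ : ℕ} (1≤ν : 1ℤ ≤ ν) (C : Constants ν) (κ≤k : Constants.κ C ℕ.≤ b 0) (hasK2 : HasK2 G k₂)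
      (k₂-small : ν * + k₂ + k ≤ + 2 * ν * k) where

      private
        Result : Set
        Result = (∀ x y → dist x y ℕ.≤ 3)
          × (Σ (Fin n → Bool) (Classification.Proper distanceRegular) ⊎ (c₂ ≡ b₁ × b₂ ≡ 1ℤ × c₃ ≡ k))

        classified : ∀ {x z} → dist x z ≡ 3 → HasSize (λ v → Adj x v × Dist G x v 1) (b 0) → Result
        classified {x} {z} xz (l , l-unique , l⇔ , ∣l∣) =
          Classification.classification distanceRegular {ν} {+ k₂} 1≤ν C {x} {z} xz
            (λ v → sphere-sum {v} {2} {k₂} (hasK2 v)) k₂-small {l} l-unique
            (All.tabulate λ {v} v∈ → Adj⇒dist≡1 (proj₁ (Equivalence.to (l⇔ v) v∈))) ∣l∣ κ≤k

        -- The pair `x`, `y` attains the diameter, turning the bound 3 into `D ≡ 3`; the neighbour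
        -- `w` is the witness that determines `c 1`.
        conclude : ∀ {x y} → Dist G x y D → 3 ℕ.≤ D → ∀ {w} → dist x w ≡ 1 → Result →
                   D ≡ 3 × (Bipartite G ⊎ IsTaylorArray D b c)
        conclude {x} {y} xy 3≤D {w} xw (diam , result) = D≡3 , [ bipartite , taylor ]′ result
          where
          D≡3 : D ≡ 3
          D≡3 = ℕₚ.≤-antisym (subst (ℕ._≤ 3) (Dist⇒dist≡ xy) (diam x y)) 3≤D
          bipartite : Σ (Fin n → Bool) (Classification.Proper distanceRegular) → Bipartite G ⊎ IsTaylorArray D b c
          bipartite (f , proper) = inj₁ (f , λ u v a → proper u v (Adj⇒dist≡1 a))
          taylor : c₂ ≡ b₁ × b₂ ≡ 1ℤ × c₃ ≡ k → Bipartite G ⊎ IsTaylorArray D b c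
          taylor (c₂≡b₁ , b₂≡1 , c₃≡k) = inj₂ (D≡3 , b 1 , refl , ℤₚ.+-injective b₂≡1 ,
            ℤₚ.+-injective (c₁≡1 {x} {w} xw) , ℤₚ.+-injective c₂≡b₁ , ℤₚ.+-injective c₃≡k)

      bipartite-or-taylor : 3 ℕ.≤ D → D ≡ 3 × (Bipartite G ⊎ IsTaylorArray D b c)
      bipartite-or-taylor 3≤D =
        let x , y , xy = proj₂ (proj₂ (proj₁ regular))
            z , xz , _ = dist-geodesic 3 (D ℕ.∸ 3) {x} {y} (trans (Dist⇒dist≡ xy) (sym (ℕₚ.m+[n∸m]≡n 3≤D)))
            w , xw , _ = dist-geodesic 1 2 {x} {z} xz
        in conclude xy 3≤D {w} xw (classified {x} {z} xz (proj₂ (proj₂ regular x x 0 (dist≡⇒Dist (dist-refl x)))))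

-- The rational hypothesis and the conclusion

open import Data.Rational using (ℚ; 0ℚ; _<_; _≤_; _-_; _*_)
open Combinatorics using (by-difference; gap; _⊕_; _⊗_; +-nonneg; module Constants; constants; module FromGraph)
open ℤ using (+_; 1ℤ)

-- A positive `ε` has numerator at least 1, so it is at least the reciprocal of its denominator. The
-- numerator's excess over 1 is the second nonnegative term, `(p - 1) * k`.
cross-multiply : ∀ ε k₂ k → 0ℚ < ε → ℕ→ℚ k₂ ≤ (ℕ→ℚ 2 - ε) * ℕ→ℚ k →
  ℚ.denominator ε ℤ.* + k₂ ℤ.+ + k ℤ.≤ + 2 ℤ.* ℚ.denominator ε ℤ.* + k
cross-multiply ε@(ℚ.mkℚ p d c) k₂ k (ℚ.*<* 0<p) h = by-difference
  (gap (ℚᵘₚ.drop-*≤* unnormalised) ⊕ gap (ℤₚ.≤-trans (ℤₚ.i<j⇒suc[i]≤j 0<p) (ℤₚ.≤-reflexive (ℤₚ.*-identityʳ p))) ⊗ +-nonneg {k})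
  (trans (certificate p (+ suc d) (+ k₂) (+ k)) (cong (λ s → (+ 2 ℤ.* + suc d ℤ.+ ℤ.- p ℤ.* 1ℤ) ℤ.* + k ℤ.* 1ℤ ℤ.- + k₂ ℤ.* s ℤ.+ (p ℤ.- 1ℤ) ℤ.* + k) (sym denominator)))
  where
  natural : ∀ m → ℚ.toℚᵘ (ℕ→ℚ m) ℚᵘ.≃ ℚᵘ.mkℚᵘ (+ m) 0
  natural m = ℚₚ.toℚᵘ-fromℚᵘ (ℚᵘ.mkℚᵘ (+ m) 0)

  unnormalised : ℚᵘ.mkℚᵘ (+ k₂) 0 ℚᵘ.≤ (ℚᵘ.mkℚᵘ (+ 2) 0 ℚᵘ.- ℚᵘ.mkℚᵘ p d) ℚᵘ.* ℚᵘ.mkℚᵘ (+ k) 0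
  unnormalised = begin
    ℚᵘ.mkℚᵘ (+ k₂) 0                                                  ≃⟨ ℚᵘₚ.≃-sym (natural k₂) ⟩
    ℚ.toℚᵘ (ℕ→ℚ k₂)                                                     ≤⟨ ℚₚ.toℚᵘ-mono-≤ h ⟩
    ℚ.toℚᵘ ((ℕ→ℚ 2 - ε) * ℕ→ℚ k)                                        ≃⟨ ℚₚ.toℚᵘ-homo-* (ℕ→ℚ 2 - ε) (ℕ→ℚ k) ⟩
    ℚ.toℚᵘ (ℕ→ℚ 2 - ε) ℚᵘ.* ℚ.toℚᵘ (ℕ→ℚ k)                                ≃⟨ ℚᵘₚ.*-cong (ℚᵘₚ.≃-trans (ℚₚ.toℚᵘ-homo-+ (ℕ→ℚ 2) (ℚ.- ε))
                                                                           (ℚᵘₚ.+-cong (natural 2) (ℚₚ.toℚᵘ-homo‿- ε))) (natural k) ⟩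
    (ℚᵘ.mkℚᵘ (+ 2) 0 ℚᵘ.- ℚᵘ.mkℚᵘ p d) ℚᵘ.* ℚᵘ.mkℚᵘ (+ k) 0           ∎
    where open ℚᵘₚ.≤-Reasoning

  denominator : ℚᵘ.↧ ((ℚᵘ.mkℚᵘ (+ 2) 0 ℚᵘ.- ℚᵘ.mkℚᵘ p d) ℚᵘ.* ℚᵘ.mkℚᵘ (+ k) 0) ≡ + suc d
  denominator = cong (λ t → + suc t) (trans (ℕₚ.*-identityʳ (d ℕ.+ 0)) (ℕₚ.+-identityʳ d))

  certificate : ∀ p s k₂ k → + 2 ℤ.* s ℤ.* k ℤ.- (s ℤ.* k₂ ℤ.+ k) ≡
    (+ 2 ℤ.* s ℤ.+ ℤ.- p ℤ.* 1ℤ) ℤ.* k ℤ.* 1ℤ ℤ.- k₂ ℤ.* s ℤ.+ (p ℤ.- 1ℤ) ℤ.* k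
  certificate = solve-∀

theorem12 : (ε : ℚ) → 0ℚ < ε →
    Σ ℕ λ κ → κ ≥ 3 ×
    ((G : Graph) (D : ℕ) (b c : ℕ → ℕ) (k₂ : ℕ) →
    IsDistanceRegular G D b c →
    D ≥ 3 →
    b 0 ≥ κ →
    HasK2 G k₂ →
    ℕ→ℚ k₂ ≤ (ℕ→ℚ 2 - ε) * ℕ→ℚ (b 0) →
    D ≡ 3 × (Bipartite G ⊎ IsTaylorArray D b c))
theorem12 ε 0<ε = 3 ℕ.+ κ , ℕₚ.m≤m+n 3 κ , λ G D b c k₂ regular D≥3 k≥κ hasK2 k₂-small →
  FromGraph.bipartite-or-taylor G regular 1≤ν (constants 1≤ν) (ℕₚ.≤-trans (ℕₚ.m≤n+m κ 3) k≥κ) hasK2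
    (cross-multiply ε k₂ (b 0) 0<ε k₂-small) D≥3
  where
  1≤ν : 1ℤ ℤ.≤ ℚ.denominator ε
  1≤ν = ℤ.+≤+ (s≤s z≤n)
  κ : ℕ
  κ = Constants.κ (constants 1≤ν)
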